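{- Let $G$ be a simple graph. Then $\hat{\pi}_3(G)=0$ if and only if $G$ satisfies both of the following conditions: (1) $G$ is triangle-free, and there exists a vertex $v\in V(G)$ such that the induced subgraph $G-v$ is bipartite; (2) there exists a bipartite subgraph $B\subseteq G$ with bipartition $(U_1,U_2)$ of $V(G)$ such that the set $E(G)\setminus E(B)$ is a (possibly empty) matching all of whose edges lie inside one and the same part $U_i$ of the bipartition.
   Context: A 3-graph is a hypergraph all of whose edges have exactly 3 vertices. The shadow $\partial(\mathcal{H})$ of a hypergraph $\mathcal{H}$ is the simple graph on $V(\mathcal{H})$ in which $uv$ is an edge iff $\{u,v\}\subseteq h$ for some edge $h$ of $\mathcal{H}$. For a simple graph $G$, a hypergraph $\mathcal{H}$ is a Berge-$G$ if there is an injection $i:V(G)\to V(\mathcal{H})$ and a bijection $f:E(G)\to E(\mathcal{H})$ with $\{i(u),i(v)\}\subseteq f(uv)$ for every $uv\in E(G)$; $\mathcal{H}$ is Berge-$G$-free if no subhypergraph of it is a Berge-$G$. $\hat{\mathrm{ex}}_3(n,G)$ is the maximum number of edges of $\partial(\mathcal{H})$ over all Berge-$G$-free 3-graphs $\mathcal{H}$ on $n$ vertices, and $\hat{\pi}_3(G)=\limsup_{n\to\infty}\hat{\mathrm{ex}}_3(n,G)/\binom{n}{2}$. -}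

module Defs where

open import Data.Nat using (ℕ; suc; _*_; _≤_)
open import Data.Nat.Combinatorics using (_C_)
open import Data.Bool using (Bool)
open import Data.Fin using (Fin; _<?_)
open import Data.Fin.Subset using (Subset; _∈_; ∣_∣)
open import Data.Fin.Subset.Properties using (_∈?_)
open import Data.List using (List; length; filter; concatMap; map; allFin)
open import Data.List.Relation.Unary.All using (All)
open import Data.List.Relation.Unary.Any using (Any; any?)
open import Data.List.Relation.Unary.Unique.Propositional using (Unique)
open import Data.Product using (Σ; ∃; ∃-syntax; _×_; _,_; proj₁; proj₂)
open import Data.Sum using (_⊎_)
open import Data.Empty using (⊥)
open import Relation.Nullary using (¬_; Dec)
open import Relation.Nullary.Decidable using (_×-dec_)
open import Relation.Binary.PropositionalEquality using (_≡_; _≢_)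
open import Data.List.Membership.Propositional using () renaming (_∈_ to _∈ₗ_)

record SimpleGraph (m : ℕ) : Set₁ where
  field
    Adj   : Fin m → Fin m → Set
    Adj?  : ∀ u v → Dec (Adj u v)
    sym   : ∀ {u v} → Adj u v → Adj v u
    irrefl : ∀ {u} → ¬ Adj u u
open SimpleGraph public

record ThreeGraph (n : ℕ) : Set where
  field
    edges    : List (Subset n)
    size3    : All (λ e → ∣ e ∣ ≡ 3) edges
    distinct : Unique edges
open ThreeGraph public

InShadow : ∀ {n} → ThreeGraph n → Fin n → Fin n → Set
InShadow H u v = Any (λ e → u ∈ e × v ∈ e) (edges H)

inShadow? : ∀ {n} (H : ThreeGraph n) (p : Fin n × Fin n) → Dec (InShadow H (proj₁ p) (proj₂ p))
inShadow? H (u , v) = any? (λ e → (u ∈? e) ×-dec (v ∈? e)) (edges H)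

pairs : (n : ℕ) → List (Fin n × Fin n)
pairs n = concatMap (λ i → map (i ,_) (filter (λ j → i <? j) (allFin n))) (allFin n)

shadowSize : ∀ {n} → ThreeGraph n → ℕ
shadowSize {n} H = length (filter (inShadow? H) (pairs n))

-- Berge copies.  A subhypergraph of H that is a Berge-G amounts to an
-- injection i : V(G) → V(H) and an injection f : E(G) → E(H)
-- (bijection onto its image, which is the subhypergraph) with
-- {i(u), i(v)} ⊆ f(uv).  An edge uv of G is given as (u , v , Adj u v);
-- f must not depend on the orientation of the edge.

record BergeCopy {m n : ℕ} (G : SimpleGraph m) (H : ThreeGraph n) : Set where
  field
    i     : Fin m → Fin n
    i-inj : ∀ {u v} → i u ≡ i v → u ≡ v
    f     : ∀ u v → Adj G u v → Σ (Subset n) (λ e → e ∈ₗ edges H)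
    f-sym : ∀ u v (p : Adj G u v) (q : Adj G v u) → proj₁ (f u v p) ≡ proj₁ (f v u q)
    f-inj : ∀ u v u' v' (p : Adj G u v) (q : Adj G u' v') →
            proj₁ (f u v p) ≡ proj₁ (f u' v' q) →
            (u ≡ u' × v ≡ v') ⊎ (u ≡ v' × v ≡ u')
    contains : ∀ u v (p : Adj G u v) → (i u ∈ proj₁ (f u v p)) × (i v ∈ proj₁ (f u v p))

BergeFree : ∀ {m n} → SimpleGraph m → ThreeGraph n → Set
BergeFree G H = ¬ BergeCopy G H

-- π̂₃(G) = 0.  Since ex̂₃(n,G)/C(n,2) ≥ 0, limsup = 0 iff for every
-- ε = 1/k (k ≥ 1) there is N with ex̂₃(n,G) ≤ C(n,2)/k for all n ≥ N,
-- i.e. every Berge-G-free 3-graph H on n vertices has k·|∂H| ≤ C(n,2).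

PiHat3Zero : ∀ {m} → SimpleGraph m → Set
PiHat3Zero G =
  ∀ (k : ℕ) → 1 ≤ k → ∃[ N ] ∀ (n : ℕ) → N ≤ n →
    ∀ (H : ThreeGraph n) → BergeFree G H → k * shadowSize H ≤ n C 2

TriangleFree : ∀ {m} → SimpleGraph m → Set
TriangleFree G = ∀ a b c → Adj G a b → Adj G b c → Adj G a c → ⊥

BipartiteMinus : ∀ {m} → SimpleGraph m → Fin m → Set
BipartiteMinus {m} G v =
  Σ (Fin m → Bool) λ c → ∀ x y → x ≢ v → y ≢ v → Adj G x y → c x ≢ c y

Condition1 : ∀ {m} → SimpleGraph m → Set
Condition1 G = TriangleFree G × ∃[ v ] BipartiteMinus G v

-- A bipartition (U₁,U₂) of V(G) is a colouring c (U₁ = c⁻¹ false,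
-- U₂ = c⁻¹ true).  B ⊆ G is a subgraph (spanning, symmetric) all of whose
-- edges cross the bipartition; the edges of G not in B form a matching
-- all of whose edges lie inside the part c⁻¹ s.
Condition2 : ∀ {m} → SimpleGraph m → Set₁
Condition2 {m} G =
  Σ (Fin m → Bool) λ c →
  Σ (Fin m → Fin m → Set) λ BAdj →
    (∀ x y → BAdj x y → Adj G x y) ×
    (∀ x y → BAdj x y → BAdj y x) ×
    (∀ x y → BAdj x y → c x ≢ c y) ×
    Σ Bool (λ s →
      (∀ x y → Adj G x y → ¬ BAdj x y → c x ≡ s × c y ≡ s) ×
      (∀ x y z → Adj G x y → ¬ BAdj x y → Adj G x z → ¬ BAdj x z → y ≡ z))

{-# OPTIONS --safe #-}

-- Necessity: take the 3-graphs with hyperedges {xᵢ , yⱼ , z_φ(j)}, whose shadow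
-- contains all pairs xᵢyⱼ.  A Berge copy of G for constant φ makes G bipartite
-- after the removal of one vertex.  A Berge copy for φ = id puts G into a
-- complete bipartite graph plus a matching inside one part, and a triangle
-- would need one hyperedge for two of its edges.
--
-- Sufficiency: from a dense shadow choose a dense set Γ of pairs with distinct
-- hyperedges {x , y , w(x,y)}.  All but few pairs xy of Γ are good: they are
-- joined by a positive proportion of all possible paths x y′ x′ y in Γ.
-- If for some w there are many disjoint good pairs xᵢyᵢ with w(xᵢ,yᵢ) = w, a
-- positive proportion of the pairs x′y′ extends many of these pairs at once to
-- such paths, which gives a blow-up of the five-cycle in which only the vertex
-- w is not blown up; it contains every G with condition (1).  Otherwise the
-- good pairs of each w are covered by boundedly many stars, so there are only
-- linearly many pairs (x , w), of linear degree on average, and many disjoint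
-- ones among them have many common third vertices y; the resulting
-- configuration contains every triangle-free G with condition (2).
module Submission where

open import Defs hiding (sym)
open import Data.Bool using (Bool; true; false; _∧_; _∨_; not)
import Data.Bool.Properties as Bool
open import Data.Empty using (⊥; ⊥-elim)
open import Data.Fin using (Fin; zero; suc; _↑ˡ_; _↑ʳ_; splitAt)
import Data.Fin as Fin
import Data.Fin.Properties as Fin
open import Data.Fin.Subset using (Subset; ⁅_⁆; ∣_∣; _∪_) renaming (_∈_ to _∈ₛ_)
import Data.Fin.Subset as Subset using (⊥)
import Data.Fin.Subset.Properties as Subset
open import Data.List using (List; []; _∷_; _++_; length; map; filter; concatMap; allFin; tabulate; cartesianProduct; cartesianProductWith)
open import Data.List.Membership.Propositional using (_∈_; _∉_; find; lose)
open import Data.List.Membership.Propositional.Properties using (∈-++⁺ˡ; ∈-++⁺ʳ; ∈-tabulate⁺; ∈-allFin; ∈-cartesianProductWith⁺; ∈-cartesianProductWith⁻)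
open import Data.List.Properties using (map-++; map-∘; map-tabulate; length-++; length-tabulate)
open import Data.List.Relation.Unary.All using (All; []; _∷_)
import Data.List.Relation.Unary.All as All
open import Data.List.Relation.Unary.AllPairs using ([]; _∷_)
open import Data.List.Relation.Unary.Any using (here; there; any?)
open import Data.List.Relation.Unary.Unique.Propositional using (Unique)
open import Data.List.Relation.Unary.Unique.Propositional.Properties using (allFin⁺; cartesianProductWith⁺)
open import Data.Nat
open import Data.Nat.Combinatorics using (nC1≡n; nCk+nC[k+1]≡[n+1]C[k+1]) renaming (_C_ to _choose_)
open import Data.Nat.ListAction using (sum)
open import Data.Nat.ListAction.Properties using (sum-++)
open import Data.Nat.Properties
open import Data.Nat.Tactic.RingSolver using (solve-∀)
open import Data.Product using (Σ; ∃; _×_; _,_; proj₁; proj₂; swap)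
open import Data.Product.Properties using (,-injectiveˡ; ,-injectiveʳ)
open import Data.Sum using (_⊎_; inj₁; inj₂; [_,_]; [_,_]′)
import Data.Sum as Sum
open import Data.Vec using ([]; _∷_; lookup) renaming (_++_ to _++ᵛ_; tabulate to tabulateᵛ)
open import Data.Vec.Properties using (lookup-++ˡ; lookup-++ʳ; lookup⇒[]=; []=⇒lookup; ++-injective; lookup∘tabulate)
open import Function using (_∘_; id; const)
open import Relation.Binary.Definitions using (tri<; tri≈; tri>)
open import Relation.Binary.PropositionalEquality hiding ([_])
open import Relation.Nullary using (¬_; Dec; yes; no; does)
open import Relation.Nullary.Decidable using (_×-dec_; _→-dec_; ¬?; decidable-stable)
open import Relation.Unary using (Decidable)

-- A Berge copy needs distinct hyperedges, while a single hyperedge puts three pairs into the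
-- shadow. So every shadow pair chooses one hyperedge containing it. Pairs that choose the same
-- hyperedge differ in the position of the third vertex in its sorted order; fixing that position
-- makes the choice injective and keeps at least a third of the pairs. From then on, distinct
-- hyperedges just means distinct pairs of Γ. Complete bipartite pieces of Γ alone embed only
-- bipartite graphs. Whatever goes beyond must come from the third vertices, so the case distinction
-- asks how strongly these are concentrated on one vertex. Densities have the form
-- `n * n ≤ k * count` with explicit `k`, so that no limits or rationals occur and all thresholds
-- are bounds on `n`. In the other direction a vanishing density only refutes that all the
-- constructed 3-graphs are Berge-`G`-free. A copy is thus available only under a double negation,
-- which is removed by deciding the conditions through a search over finitely many colourings.

private variable
  A B : Set
  m n : ℕ

-- Sums over lists

∑ : List A → (A → ℕ) → ℕ
∑ xs f = sum (map f xs)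

∑-mono : ∀ (xs : List A) {f g : A → ℕ} → (∀ a → f a ≤ g a) → ∑ xs f ≤ ∑ xs g
∑-mono []       f≤g = z≤n
∑-mono (x ∷ xs) f≤g = +-mono-≤ (f≤g x) (∑-mono xs f≤g)

∑-cong : ∀ (xs : List A) {f g : A → ℕ} → (∀ a → f a ≡ g a) → ∑ xs f ≡ ∑ xs g
∑-cong []       f≡g = refl
∑-cong (x ∷ xs) f≡g = cong₂ _+_ (f≡g x) (∑-cong xs f≡g)

∑-+ : ∀ (xs : List A) (f g : A → ℕ) → ∑ xs (λ a → f a + g a) ≡ ∑ xs f + ∑ xs g
∑-+ []       f g = refl
∑-+ (x ∷ xs) f g rewrite ∑-+ xs f g = interchange (f x) (g x) (∑ xs f) (∑ xs g)
  where
  interchange : ∀ a b c d → a + b + (c + d) ≡ a + c + (b + d)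
  interchange = solve-∀

∑-* : ∀ (xs : List A) c (f : A → ℕ) → ∑ xs (λ a → c * f a) ≡ c * ∑ xs f
∑-* []       c f = sym (*-zeroʳ c)
∑-* (x ∷ xs) c f rewrite ∑-* xs c f = sym (*-distribˡ-+ c (f x) (∑ xs f))

∑-const : ∀ (xs : List A) c → ∑ xs (λ _ → c) ≡ length xs * c
∑-const []       c = refl
∑-const (x ∷ xs) c = cong (c +_) (∑-const xs c)

∑-swap : ∀ (xs : List A) (ys : List B) (f : A → B → ℕ) →
         ∑ xs (λ a → ∑ ys (f a)) ≡ ∑ ys (λ b → ∑ xs (λ a → f a b))
∑-swap []       ys f = sym (trans (∑-const ys 0) (*-zeroʳ (length ys)))
∑-swap (x ∷ xs) ys f = begin
  ∑ ys (f x) + ∑ xs (λ a → ∑ ys (f a))           ≡⟨ cong (∑ ys (f x) +_) (∑-swap xs ys f) ⟩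
  ∑ ys (f x) + ∑ ys (λ b → ∑ xs (λ a → f a b))   ≡⟨ ∑-+ ys (f x) _ ⟨
  ∑ ys (λ b → f x b + ∑ xs (λ a → f a b))        ∎
  where open ≡-Reasoning

∑-∈ : ∀ {xs : List A} {a} (f : A → ℕ) → a ∈ xs → f a ≤ ∑ xs f
∑-∈ {xs = x ∷ xs} f (here refl) = m≤m+n (f x) (∑ xs f)
∑-∈ {xs = x ∷ xs} f (there a∈)  = ≤-trans (∑-∈ f a∈) (m≤n+m (∑ xs f) (f x))

∑-<-witness : ∀ (xs : List A) {f g : A → ℕ} → ∑ xs f < ∑ xs g → ∃ λ a → f a < g a
∑-<-witness (x ∷ xs) {f} {g} lt with f x <? g x
... | yes p = x , p
... | no ¬p = ∑-<-witness xs (≰⇒> λ ≥ → <⇒≱ lt (+-mono-≤ (≮⇒≥ ¬p) ≥))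

∑-allFin-suc : ∀ n (f : Fin (suc n) → ℕ) → ∑ (allFin (suc n)) f ≡ f zero + ∑ (allFin n) (f ∘ suc)
∑-allFin-suc n f = cong (λ l → f zero + sum l)
  (trans (map-tabulate suc f) (sym (map-tabulate id (f ∘ suc))))

length-allFin : ∀ n → length (allFin n) ≡ n
length-allFin n = length-tabulate {n = n} id

∑-allFin-const : ∀ n c → ∑ (allFin n) (λ _ → c) ≡ n * c
∑-allFin-const n c = trans (∑-const (allFin n) c) (cong (_* c) (length-allFin n))

-- Indicators and counting

⟦_⟧ : Bool → ℕ
⟦ true ⟧  = 1
⟦ false ⟧ = 0

⟦⟧≤1 : ∀ b → ⟦ b ⟧ ≤ 1
⟦⟧≤1 true  = ≤-refl
⟦⟧≤1 false = z≤n

⟦⟧-mono : ∀ {a b} → (a ≡ true → b ≡ true) → ⟦ a ⟧ ≤ ⟦ b ⟧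
⟦⟧-mono {false} f = z≤n
⟦⟧-mono {true}  f rewrite f refl = ≤-refl

⟦∧⟧ : ∀ a b → ⟦ a ∧ b ⟧ ≡ ⟦ a ⟧ * ⟦ b ⟧
⟦∧⟧ true  b = sym (+-identityʳ ⟦ b ⟧)
⟦∧⟧ false b = refl

∧-true⁻ : ∀ {a b} → a ∧ b ≡ true → a ≡ true × b ≡ true
∧-true⁻ {true} b≡ = refl , b≡

∧-true⁺ : ∀ {a b} → a ≡ true → b ≡ true → a ∧ b ≡ true
∧-true⁺ refl refl = refl

does⁻ : ∀ {P : Set} (d : Dec P) → does d ≡ true → P
does⁻ (yes p) _ = p

does⁺ : ∀ {P : Set} (d : Dec P) → P → does d ≡ true
does⁺ (yes _) _ = refl
does⁺ (no ¬p) p = ⊥-elim (¬p p)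

# : List A → (A → Bool) → ℕ
# xs p = ∑ xs (λ a → ⟦ p a ⟧)

#≤length : ∀ (xs : List A) p → # xs p ≤ length xs
#≤length xs p = ≤-trans (∑-mono xs (⟦⟧≤1 ∘ p))
  (≤-reflexive (trans (∑-const xs 1) (*-identityʳ _)))

_∈?_ : (x : Fin n) (xs : List (Fin n)) → Dec (x ∈ xs)
x ∈? xs = any? (x Fin.≟_) xs

#-≡ : ∀ (xs : List (Fin n)) z → Unique xs → # xs (λ x → does (x Fin.≟ z)) ≤ 1
#-≡ []       z []       = z≤n
#-≡ (x ∷ xs) z (x∉ ∷ u) with x Fin.≟ z
... | no _     = #-≡ xs z u
... | yes refl = s≤s (go xs x∉)
  where
  go : ∀ ys → All (x ≢_) ys → # ys (λ y → does (y Fin.≟ x)) ≤ 0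
  go []       []        = z≤n
  go (y ∷ ys) (x≢y ∷ a) with y Fin.≟ x
  ... | yes y≡x = ⊥-elim (x≢y (sym y≡x))
  ... | no _    = go ys a

#-∈≤length : ∀ (C : List (Fin n)) → # (allFin n) (λ x → does (x ∈? C)) ≤ length C
#-∈≤length {n} [] = ≤-reflexive (trans (∑-const (allFin n) 0) (*-zeroʳ (length (allFin n))))
#-∈≤length {n} (c ∷ C) = begin
  # V (λ x → does (x ∈? (c ∷ C)))                             ≤⟨ ∑-mono V split ⟩
  ∑ V (λ x → ⟦ does (x Fin.≟ c) ⟧ + ⟦ does (x ∈? C) ⟧)        ≡⟨ ∑-+ V _ _ ⟩
  # V (λ x → does (x Fin.≟ c)) + # V (λ x → does (x ∈? C))    ≤⟨ +-mono-≤ (#-≡ V c (allFin⁺ n)) (#-∈≤length C) ⟩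
  1 + length C                                                ∎
  where
  open ≤-Reasoning
  V = allFin n
  split : ∀ x → ⟦ does (x ∈? (c ∷ C)) ⟧ ≤ ⟦ does (x Fin.≟ c) ⟧ + ⟦ does (x ∈? C) ⟧
  split x with x Fin.≟ c
  ... | yes _ = s≤s z≤n
  ... | no _  = ≤-refl

-- Greedy choice: each chosen vertex moves into `F`, so `t + length F` is invariant under the
-- recursion.
pick : ∀ t (F : List (Fin n)) (p : Fin n → Bool) → t + length F ≤ # (allFin n) p →
       Σ (Fin t → Fin n) λ g → (∀ {i j} → g i ≡ g j → i ≡ j) × (∀ i → p (g i) ≡ true × g i ∉ F)
pick zero    F p h = (λ ()) , (λ { {()} }) , λ ()
pick {n} (suc t) F p h
  with x , lt ← ∑-<-witness (allFin n) (<-≤-trans (s≤s (≤-trans (#-∈≤length F) (m≤n+m _ t))) h)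
  with x ∈? F | p x in px | lt
... | yes _  | true  | s≤s ()
... | no x∉F | false | ()
... | no x∉F | true  | _
  with g , g-inj , gp ← pick t (x ∷ F) p (≤-trans (≤-reflexive (+-suc t (length F))) h)
  = g′ , inj , λ { zero → px , x∉F ; (suc i) → proj₁ (gp i) , proj₂ (gp i) ∘ there }
  where
  g′ : Fin (suc t) → Fin n
  g′ zero    = x
  g′ (suc i) = g i
  inj : ∀ {i j} → g′ i ≡ g′ j → i ≡ j
  inj {zero}  {zero}  _ = refl
  inj {zero}  {suc j} e = ⊥-elim (proj₂ (gp j) (here (sym e)))
  inj {suc i} {zero}  e = ⊥-elim (proj₂ (gp i) (here e))
  inj {suc i} {suc j} e = cong suc (g-inj e)

-- Several dense sets with a dense common part

Common : (L : List B) (K N s T : ℕ) → (B → Bool) → (Fin T → B → Bool) → Set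
Common {B} L K N s T r p =
  Σ (Fin s → Fin T) λ σ → (∀ {i j} → σ i ≡ σ j → i ≡ j) ×
  Σ (B → Bool) λ q → N ≤ K * # L q × (∀ b → q b ≡ true → r b ≡ true) ×
  (∀ b → q b ≡ true → ∀ i → p (σ i) b ≡ true)

module _ (L : List B) (K N : ℕ) where
  open ≤-Reasoning

  -- Splitting r by the first predicate doubles the error term 2 ^ T * N.
  common-or-sparse : ∀ T s (r : B → Bool) (p : Fin T → B → Bool) →
    Common L K N s T r p ⊎
    K * (∑ (allFin T) (λ j → # L (λ b → r b ∧ p j b)) + # L r) ≤ K * (s * # L r) + 2 ^ T * N
  -- Nothing remains to be chosen. Either `r` itself is the dense set, or `K * # L r ≤ N`, and this
  -- quantity occurs at most `T + 1 ≤ 2 ^ T` times on the left.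
  common-or-sparse T zero r p with N ≤? K * # L r
  ... | yes dense = inj₁ ((λ ()) , (λ { {()} }) , r , dense , (λ _ → id) , λ _ _ ())
  ... | no ¬dense = inj₂ (begin
    K * (∑ (allFin T) (λ j → # L (λ b → r b ∧ p j b)) + # L r) ≤⟨ *-monoʳ-≤ K (+-monoˡ-≤ (# L r) (∑-mono (allFin T) {g = λ _ → # L r} λ j → ∑-mono L λ b → ⟦⟧-mono (proj₁ ∘ ∧-true⁻))) ⟩
    K * (∑ (allFin T) (λ _ → # L r) + # L r) ≡⟨ cong (λ z → K * (z + # L r)) (∑-allFin-const T (# L r)) ⟩
    K * (T * # L r + # L r) ≡⟨ eq K T (# L r) ⟩
    suc T * (K * # L r)  ≤⟨ *-mono-≤ (n<2^n T) (≰⇒≥ ¬dense) ⟩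
    2 ^ T * N ≤⟨ m≤n+m _ _ ⟩
    K * (0 * # L r) + 2 ^ T * N ∎)
    where
    eq : ∀ K T c → K * (T * c + c) ≡ suc T * (K * c)
    eq = solve-∀
    n<2^n : ∀ n → suc n ≤ 2 ^ n
    n<2^n zero    = ≤-refl
    n<2^n (suc n) = +-mono-≤ (m^n>0 2 n) (≤-trans (n<2^n n) (m≤m+n _ 0))
  common-or-sparse zero (suc s) r p = inj₂ (begin
    K * # L r                          ≤⟨ *-monoʳ-≤ K (m≤m+n _ _) ⟩
    K * (suc s * # L r)                ≤⟨ m≤m+n _ _ ⟩
    K * (suc s * # L r) + 1 * N        ∎)
  -- Outside `p zero` all `suc s` sets must come from the later ones; inside it `s` later ones
  -- suffice, and the set saved there pays for the extra `K * r₁`.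
  common-or-sparse (suc T) (suc s) r p
    with common-or-sparse T (suc s) (λ b → r b ∧ not (p zero b)) (p ∘ suc)
       | common-or-sparse T s (λ b → r b ∧ p zero b) (p ∘ suc)
  ... | inj₁ (σ , inj , q , dense , qr , qp) | _ =
    inj₁ (suc ∘ σ , inj ∘ Fin.suc-injective , q , dense , (λ b → proj₁ ∘ ∧-true⁻ ∘ qr b) , qp)
  ... | inj₂ _ | inj₁ (σ , inj , q , dense , qr , qp) =
    inj₁ (σ′ , inj′ , q , dense , (λ b → proj₁ ∘ ∧-true⁻ ∘ qr b)
         , λ { b qb zero → proj₂ (∧-true⁻ (qr b qb)) ; b qb (suc i) → qp b qb i })
    where
    σ′ : Fin (suc s) → Fin (suc T)
    σ′ zero    = zero
    σ′ (suc i) = suc (σ i)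
    inj′ : ∀ {i j} → σ′ i ≡ σ′ j → i ≡ j
    inj′ {zero}  {zero}  e = refl
    inj′ {suc i} {suc j} e = cong suc (inj (Fin.suc-injective e))
  ... | inj₂ h₀ | inj₂ h₁ = inj₂ (begin
    K * (∑ (allFin (suc T)) (λ j → # L (λ b → r b ∧ p j b)) + # L r)
      ≡⟨ cong₂ (λ y z → K * (y + z)) (trans (∑-allFin-suc T _) (cong (r₁ +_) (trans (∑-cong (allFin T) splitⱼ) (∑-+ (allFin T) _ _)))) splitᵣ ⟩
    K * (r₁ + (S₀ + S₁) + (r₀ + r₁))            ≡⟨ eq₁ K r₀ r₁ S₀ S₁ ⟩
    K * (S₀ + r₀) + K * (S₁ + r₁) + K * r₁      ≤⟨ +-monoˡ-≤ (K * r₁) (+-mono-≤ h₀ h₁) ⟩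
    (K * (suc s * r₀) + 2 ^ T * N) + (K * (s * r₁) + 2 ^ T * N) + K * r₁ ≡⟨ eq₂ K s r₀ r₁ (2 ^ T) N ⟩
    K * (suc s * (r₀ + r₁)) + 2 * 2 ^ T * N     ≡⟨ cong (λ z → K * (suc s * z) + 2 * 2 ^ T * N) splitᵣ ⟨
    K * (suc s * # L r) + 2 ^ suc T * N         ∎)
    where
    r₀ r₁ S₀ S₁ : ℕ
    r₀ = # L (λ b → r b ∧ not (p zero b))
    r₁ = # L (λ b → r b ∧ p zero b)
    S₀ = ∑ (allFin T) (λ j → # L (λ b → (r b ∧ not (p zero b)) ∧ p (suc j) b))
    S₁ = ∑ (allFin T) (λ j → # L (λ b → (r b ∧ p zero b) ∧ p (suc j) b))
    case : ∀ a b c → ⟦ a ∧ c ⟧ ≡ ⟦ (a ∧ not b) ∧ c ⟧ + ⟦ (a ∧ b) ∧ c ⟧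
    case true true c = refl
    case true false c = sym (+-identityʳ _)
    case false b c = refl
    case′ : ∀ a b → ⟦ a ⟧ ≡ ⟦ a ∧ not b ⟧ + ⟦ a ∧ b ⟧
    case′ true true = refl
    case′ true false = refl
    case′ false b = refl
    splitᵣ : # L r ≡ r₀ + r₁
    splitᵣ = trans (∑-cong L λ b → case′ (r b) (p zero b)) (∑-+ L _ _)
    splitⱼ : ∀ j → # L (λ b → r b ∧ p (suc j) b) ≡
      # L (λ b → (r b ∧ not (p zero b)) ∧ p (suc j) b) + # L (λ b → (r b ∧ p zero b) ∧ p (suc j) b)
    splitⱼ j = trans (∑-cong L λ b → case (r b) (p zero b) (p (suc j) b)) (∑-+ L _ _)
    eq₁ : ∀ K a b S S' → K * (b + (S + S') + (a + b)) ≡ K * (S + a) + K * (S' + b) + K * b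
    eq₁ = solve-∀
    eq₂ : ∀ K s a b D N → (K * (suc s * a) + D * N) + (K * (s * b) + D * N) + K * b ≡ K * (suc s * (a + b)) + 2 * D * N
    eq₂ = solve-∀

-- Averaging: an element lies in at least `s` of the `k * s` sets on average, as each has density at
-- least 1/k. The sparse alternative, with `T = k * s`, bounds this average by s - 1 + 2^T/K, which
-- is less than `s` for `K = 2 ^ T + 1`.
common : ∀ (L : List B) k s (p : Fin (k * s) → B → Bool) → 0 < k → 0 < length L →
         (∀ j → length L ≤ k * # L (p j)) →
         Common L (suc (2 ^ (k * s))) (length L) s (k * s) (λ _ → true) p
common L k s p k>0 N>0 dense
  with common-or-sparse L (suc (2 ^ (k * s))) (length L) (k * s) s (λ _ → true) p
... | inj₁ c = c
... | inj₂ h = ⊥-elim (<⇒≱ (*-mono-< k>0 N>0) (+-cancelˡ-≤ (K′ * (k * s * N)) _ _ (begin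
  K′ * (k * s * N) + k * N                ≤⟨ +-cancelʳ-≤ (P * (k * N)) _ _ (begin
    K′ * (k * s * N) + k * N + P * (k * N)  ≡⟨ eq₁ P k (k * s * N) N ⟩
    K′ * (k * s * N + k * N)                ≤⟨ *-monoʳ-≤ K′ (+-monoˡ-≤ (k * N) bound) ⟩
    K′ * (k * S + k * N)                    ≡⟨ eq₂ K′ k S N ⟩
    k * (K′ * (S + N))                      ≡⟨ cong (λ z → k * (K′ * (S + z))) #true ⟨
    k * (K′ * (S + # L (λ _ → true)))       ≤⟨ *-monoʳ-≤ k h ⟩
    k * (K′ * (s * # L (λ _ → true)) + P * N) ≡⟨ cong (λ z → k * (K′ * (s * z) + P * N)) #true ⟩
    k * (K′ * (s * N) + P * N)              ≡⟨ eq₃ k K′ s N P ⟩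
    K′ * (k * s * N) + 0 + P * (k * N)          ∎) ⟩
  K′ * (k * s * N) + 0                        ∎)))
  where
  open ≤-Reasoning
  P K′ N S : ℕ
  P = 2 ^ (k * s)
  K′ = suc P
  N = length L
  S = ∑ (allFin (k * s)) (λ j → # L (p j))
  #true : # L (λ _ → true) ≡ N
  #true = trans (∑-const L 1) (*-identityʳ N)
  bound : k * s * N ≤ k * S
  bound = begin
    k * s * N                                  ≡⟨ ∑-allFin-const (k * s) N ⟨
    ∑ (allFin (k * s)) (λ _ → N)               ≤⟨ ∑-mono (allFin (k * s)) dense ⟩
    ∑ (allFin (k * s)) (λ j → k * # L (p j))   ≡⟨ ∑-* (allFin (k * s)) k _ ⟩
    k * S                                      ∎
  eq₁ : ∀ P k a N → suc P * a + k * N + P * (k * N) ≡ suc P * (a + k * N)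
  eq₁ = solve-∀
  eq₂ : ∀ K k S N → K * (k * S + k * N) ≡ k * (K * (S + N))
  eq₂ = solve-∀
  eq₃ : ∀ k K s N P → k * (K * (s * N) + P * N) ≡ K * (k * s * N) + 0 + P * (k * N)
  eq₃ = solve-∀

-- Dense relations

∑-cartesianProduct : ∀ (xs : List A) (ys : List B) (f : A × B → ℕ) →
  ∑ (cartesianProduct xs ys) f ≡ ∑ xs (λ x → ∑ ys (λ y → f (x , y)))
∑-cartesianProduct []       ys f = refl
∑-cartesianProduct (x ∷ xs) ys f = begin
  sum (map f (map (x ,_) ys ++ cartesianProduct xs ys))  ≡⟨ cong sum (map-++ f (map (x ,_) ys) _) ⟩
  sum (map f (map (x ,_) ys) ++ map f (cartesianProduct xs ys)) ≡⟨ sum-++ (map f (map (x ,_) ys)) _ ⟩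
  sum (map f (map (x ,_) ys)) + ∑ (cartesianProduct xs ys) f ≡⟨ cong₂ _+_ (cong sum (sym (map-∘ ys))) (∑-cartesianProduct xs ys f) ⟩
  ∑ ys (λ y → f (x , y)) + ∑ xs (λ x → ∑ ys (λ y → f (x , y))) ∎
  where open ≡-Reasoning

ab≤aa+bb : ∀ a b → a * b ≤ a * a + b * b
ab≤aa+bb a b with ≤-total a b
... | inj₁ a≤b = ≤-trans (*-monoˡ-≤ b a≤b) (m≤n+m _ _)
... | inj₂ b≤a = ≤-trans (*-monoʳ-≤ a b≤a) (m≤m+n _ _)

-- A form of Cauchy-Schwarz: sum 2κN f ≤ (2κ f)² + N² over `xs` and cancel. Using `ab≤aa+bb` instead
-- of 2ab ≤ a² + b² costs the factor 4 in (2κ)².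
second-moment : ∀ (xs : List A) (f : A → ℕ) N κ → length xs * N ≤ κ * ∑ xs f →
                length xs * (N * N) ≤ 2 * κ * (2 * κ) * ∑ xs (λ a → f a * f a)
second-moment xs f N κ h = +-cancelʳ-≤ (length xs * (N * N)) _ _ (begin
  length xs * (N * N) + length xs * (N * N)      ≡⟨ eq₁ (length xs) N ⟩
  2 * N * (length xs * N)                        ≤⟨ *-monoʳ-≤ (2 * N) h ⟩
  2 * N * (κ * ∑ xs f)                           ≡⟨ eq₂ N κ (∑ xs f) ⟩
  2 * κ * N * ∑ xs f                             ≡⟨ ∑-* xs (2 * κ * N) f ⟨
  ∑ xs (λ a → 2 * κ * N * f a)                   ≤⟨ ∑-mono xs step ⟩
  ∑ xs (λ a → 2 * κ * (2 * κ) * (f a * f a) + N * N) ≡⟨ ∑-+ xs _ _ ⟩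
  ∑ xs (λ a → 2 * κ * (2 * κ) * (f a * f a)) + ∑ xs (λ _ → N * N) ≡⟨ cong₂ _+_ (∑-* xs (2 * κ * (2 * κ)) _) (∑-const xs (N * N)) ⟩
  2 * κ * (2 * κ) * ∑ xs (λ a → f a * f a) + length xs * (N * N) ∎)
  where
  open ≤-Reasoning
  eq₁ : ∀ l N → l * (N * N) + l * (N * N) ≡ 2 * N * (l * N)
  eq₁ = solve-∀
  eq₂ : ∀ N k S → 2 * N * (k * S) ≡ 2 * k * N * S
  eq₂ = solve-∀
  eq₃ : ∀ k N a → 2 * k * N * a ≡ 2 * k * a * N
  eq₃ = solve-∀
  eq₄ : ∀ k N a → 2 * k * a * (2 * k * a) + N * N ≡ 2 * k * (2 * k) * (a * a) + N * N
  eq₄ = solve-∀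
  step : ∀ a → 2 * κ * N * f a ≤ 2 * κ * (2 * κ) * (f a * f a) + N * N
  step a = begin
    2 * κ * N * f a                           ≡⟨ eq₃ κ N (f a) ⟩
    2 * κ * f a * N                           ≤⟨ ab≤aa+bb (2 * κ * f a) N ⟩
    2 * κ * f a * (2 * κ * f a) + N * N       ≡⟨ eq₄ κ N (f a) ⟩
    2 * κ * (2 * κ) * (f a * f a) + N * N     ∎

## : (Fin n → Fin n → Bool) → ℕ
## {n} R = ∑ (allFin n) λ x → # (allFin n) (R x)

##-mono : ∀ {R S : Fin n → Fin n → Bool} → (∀ x y → R x y ≡ true → S x y ≡ true) → ## R ≤ ## S
##-mono {n} h = ∑-mono (allFin n) λ x → ∑-mono (allFin n) λ y → ⟦⟧-mono (h x y)

##-≤+ : ∀ {R S₁ S₂ : Fin n → Fin n → Bool} →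
        (∀ x y → R x y ≡ true → S₁ x y ≡ true ⊎ S₂ x y ≡ true) → ## R ≤ ## S₁ + ## S₂
##-≤+ {n} {R} {S₁} {S₂} h = ≤-trans
  (∑-mono (allFin n) λ x → ≤-trans (∑-mono (allFin n) (pt x)) (≤-reflexive (∑-+ (allFin n) _ _)))
  (≤-reflexive (∑-+ (allFin n) _ _))
  where
  pt : ∀ x y → ⟦ R x y ⟧ ≤ ⟦ S₁ x y ⟧ + ⟦ S₂ x y ⟧
  pt x y with R x y in eq
  ... | false = z≤n
  ... | true with h x y eq
  ...   | inj₁ e rewrite e = s≤s z≤n
  ...   | inj₂ e rewrite e = m≤n+m 1 ⟦ S₁ x y ⟧

##-transpose : ∀ (R : Fin n → Fin n → Bool) → ## R ≡ ## (λ x y → R y x)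
##-transpose {n} R = ∑-swap (allFin n) (allFin n) (λ x y → ⟦ R x y ⟧)

-- Pairs joined by many paths of length three

V² : ∀ n → List (Fin n × Fin n)
V² n = cartesianProduct (allFin n) (allFin n)

length-V² : ∀ n → length (V² n) ≡ n * n
length-V² n = begin
  length (V² n)                             ≡⟨ *-identityʳ _ ⟨
  length (V² n) * 1                         ≡⟨ ∑-const (V² n) 1 ⟨
  ∑ (V² n) (λ _ → 1)                        ≡⟨ ∑-cartesianProduct (allFin n) (allFin n) _ ⟩
  ∑ (allFin n) (λ _ → ∑ (allFin n) λ _ → 1) ≡⟨ ∑-cong (allFin n) (λ _ → trans (∑-allFin-const n 1) (*-identityʳ n)) ⟩
  ∑ (allFin n) (λ _ → n)                    ≡⟨ ∑-allFin-const n n ⟩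
  n * n                                     ∎
  where open ≡-Reasoning

##≡# : ∀ (R : Fin n → Fin n → Bool) → # (V² n) (λ (x , y) → R x y) ≡ ## R
##≡# {n} R = ∑-cartesianProduct (allFin n) (allFin n) _

-- The pairs (x′ , y′) for which x y′ x′ y is a path.
path₃ : (Fin n → Fin n → Bool) → Fin n → Fin n → Fin n → Fin n → Bool
path₃ R x y x′ y′ = R x y′ ∧ R x′ y′ ∧ R x′ y

-- The loss κ ↦ (2κ)² of `second-moment`, incurred twice: for the degrees of vertices and for the
-- codegrees of pairs.
pathConst : ℕ → ℕ
pathConst κ = let κ₂ = 2 * κ * (2 * κ) in 2 * κ₂ * (2 * κ₂)

-- The sum of ## (path₃ R x y) over the edges is the number of closed
-- 4-walks, which is bounded from below by convexity, applied twice.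
edge-with-many-paths : ∀ (R : Fin n → Fin n → Bool) κ → 0 < n → n * n ≤ κ * ## R →
  ∃ λ x → ∃ λ y → R x y ≡ true × n * n ≤ pathConst κ * ## (path₃ R x y)
edge-with-many-paths {n} R κ n>0 dense = conclude
  where
  open ≤-Reasoning
  V = allFin n
  κ₂ = 2 * κ * (2 * κ)
  r : Fin n → Fin n → ℕ
  r x y = ⟦ R x y ⟧
  codeg : Fin n × Fin n → ℕ
  codeg (y , y′) = ∑ V λ x → r x y * r x y′

  ∑-square : ∀ {A : Set} (xs : List A) (f : A → ℕ) → ∑ xs f * ∑ xs f ≡ ∑ xs (λ a → ∑ xs (λ b → f a * f b))
  ∑-square xs f = trans (sym (∑-* xs (∑ xs f) f)) (∑-cong xs λ a → trans (*-comm (∑ xs f) (f a)) (sym (∑-* xs (f a) f)))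

  cherries : ∑ V (λ x → # V (R x) * # V (R x)) ≡ ∑ (V² n) codeg
  cherries = begin-equality
    ∑ V (λ x → # V (R x) * # V (R x))                       ≡⟨ ∑-cong V (λ x → ∑-square V (r x)) ⟩
    ∑ V (λ x → ∑ V λ y → ∑ V λ y′ → r x y * r x y′)         ≡⟨ ∑-swap V V _ ⟩
    ∑ V (λ y → ∑ V λ x → ∑ V λ y′ → r x y * r x y′)         ≡⟨ ∑-cong V (λ y → ∑-swap V V _) ⟩
    ∑ V (λ y → ∑ V λ y′ → ∑ V λ x → r x y * r x y′)         ≡⟨ ∑-cartesianProduct V V codeg ⟨
    ∑ (V² n) codeg                                          ∎

  first : n * (n * n) ≤ κ₂ * ∑ (V² n) codeg
  first = subst (λ l → l * (n * n) ≤ κ₂ * ∑ (V² n) codeg) (length-allFin n)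
    (subst (λ S → length V * (n * n) ≤ κ₂ * S) cherries
      (second-moment V (λ x → # V (R x)) n κ (subst (λ l → l * n ≤ κ * ## R) (sym (length-allFin n)) dense)))

  second : n * n * (n * n) ≤ pathConst κ * ∑ (V² n) (λ e → codeg e * codeg e)
  second = subst (λ l → l * (n * n) ≤ pathConst κ * ∑ (V² n) (λ e → codeg e * codeg e)) (length-V² n)
    (second-moment (V² n) codeg n κ₂ (≤-trans (≤-reflexive (trans (cong (_* n) (length-V² n)) (*-assoc n n n))) first))

  -- Squared codegrees count quadruples x, x′, y, y′ with all four pairs related. Grouped by the
  -- pair xy, the other three pairs form the path x y′ x′ y.
  closed : ∑ (V² n) (λ e → codeg e * codeg e) ≡ ∑ (V² n) (λ (x , y) → r x y * ## (path₃ R x y))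
  closed = begin-equality
    ∑ (V² n) (λ e → codeg e * codeg e)                                              ≡⟨ ∑-cartesianProduct V V _ ⟩
    ∑ V (λ y → ∑ V λ y′ → codeg (y , y′) * codeg (y , y′))                          ≡⟨ ∑-cong V (λ y → ∑-cong V λ y′ → ∑-square V _) ⟩
    ∑ V (λ y → ∑ V λ y′ → ∑ V λ x → ∑ V λ x′ → (r x y * r x y′) * (r x′ y * r x′ y′)) ≡⟨ ∑-cong V (λ y → ∑-swap V V _) ⟩
    ∑ V (λ y → ∑ V λ x → ∑ V λ y′ → ∑ V λ x′ → (r x y * r x y′) * (r x′ y * r x′ y′)) ≡⟨ ∑-swap V V _ ⟩
    ∑ V (λ x → ∑ V λ y → ∑ V λ y′ → ∑ V λ x′ → (r x y * r x y′) * (r x′ y * r x′ y′)) ≡⟨ ∑-cong V (λ x → ∑-cong V λ y → ∑-swap V V _) ⟩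
    ∑ V (λ x → ∑ V λ y → ∑ V λ x′ → ∑ V λ y′ → (r x y * r x y′) * (r x′ y * r x′ y′)) ≡⟨ ∑-cong V (λ x → ∑-cong V λ y → ∑-cong V λ x′ → ∑-cong V λ y′ → pt (R x y) (R x y′) (R x′ y) (R x′ y′)) ⟩
    ∑ V (λ x → ∑ V λ y → ∑ V λ x′ → ∑ V λ y′ → r x y * ⟦ path₃ R x y x′ y′ ⟧)       ≡⟨ ∑-cong V (λ x → ∑-cong V λ y → trans (∑-cong V λ x′ → ∑-* V (r x y) _) (∑-* V (r x y) _)) ⟩
    ∑ V (λ x → ∑ V λ y → r x y * ## (path₃ R x y))                                  ≡⟨ ∑-cartesianProduct V V _ ⟨
    ∑ (V² n) (λ (x , y) → r x y * ## (path₃ R x y))                                 ∎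
    where
    pt : ∀ a b c d → (⟦ a ⟧ * ⟦ b ⟧) * (⟦ c ⟧ * ⟦ d ⟧) ≡ ⟦ a ⟧ * ⟦ b ∧ d ∧ c ⟧
    pt false b c d = refl
    pt true false c d = refl
    pt true true false false = refl
    pt true true false true = refl
    pt true true true false = refl
    pt true true true true = refl

  n²>0 : 0 < n * n
  n²>0 = *-mono-< n>0 n>0

  -- Lowering `n * n` to its predecessor gives the strict inequality that `∑-<-witness` needs. At
  -- the witness, strictness restores `n * n` and also forces `R x y` to hold.
  total : ∑ (V² n) (λ _ → pred (n * n)) < ∑ (V² n) (λ (x , y) → pathConst κ * (r x y * ## (path₃ R x y)))
  total = begin-strict
    ∑ (V² n) (λ _ → pred (n * n))       ≡⟨ ∑-const (V² n) _ ⟩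
    length (V² n) * pred (n * n)        ≡⟨ cong (_* pred (n * n)) (length-V² n) ⟩
    n * n * pred (n * n)                <⟨ *-monoʳ-< (n * n) {{>-nonZero n²>0}} (pred-< n²>0) ⟩
    n * n * (n * n)                     ≤⟨ second ⟩
    pathConst κ * ∑ (V² n) (λ e → codeg e * codeg e) ≡⟨ cong (pathConst κ *_) closed ⟩
    pathConst κ * ∑ (V² n) (λ (x , y) → r x y * ## (path₃ R x y)) ≡⟨ ∑-* (V² n) (pathConst κ) _ ⟨
    ∑ (V² n) (λ (x , y) → pathConst κ * (r x y * ## (path₃ R x y))) ∎
    where
    pred-< : ∀ {m} → 0 < m → pred m < m
    pred-< (s≤s _) = ≤-refl

  conclude : ∃ λ x → ∃ λ y → R x y ≡ true × n * n ≤ pathConst κ * ## (path₃ R x y)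
  extract : ∀ N c b w → pred N < c * (⟦ b ⟧ * w) → b ≡ true × N ≤ c * w
  extract N       c false w lt = ⊥-elim (n≮0 (≤-trans lt (≤-reflexive (*-zeroʳ c))))
  extract zero    c true  w lt = refl , z≤n
  extract (suc N) c true  w lt = refl , ≤-trans lt (≤-reflexive (cong (c *_) (+-identityʳ w)))

  conclude =
    let (x , y) , lt = ∑-<-witness (V² n) total
    in x , y , extract (n * n) (pathConst κ) (R x y) (## (path₃ R x y)) lt

good : (Fin n → Fin n → Bool) → ℕ → Fin n → Fin n → Bool
good {n} R c x y = R x y ∧ does (n * n ≤? c * ## (path₃ R x y))

-- If the bad pairs were dense, `edge-with-many-paths` applied to the bad pairs alone would yield a
-- bad pair with many paths of bad pairs. These are paths in `R`, so the pair would be good. Hence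
-- the bad pairs cost at most half of the density.
many-good : ∀ (R : Fin n → Fin n → Bool) k → 0 < n → n * n ≤ k * ## R →
            n * n ≤ 2 * k * ## (good R (pathConst (2 * k)))
many-good {n} R k n>0 dense = +-cancelʳ-≤ (n * n) _ _ (begin
  n * n + n * n                          ≤⟨ +-mono-≤ dense dense ⟩
  k * ## R + k * ## R                    ≡⟨ eq k (## R) ⟩
  2 * k * ## R                           ≤⟨ *-monoʳ-≤ (2 * k) (##-≤+ {R = R} {S₁ = good R c} {S₂ = bad} split) ⟩
  2 * k * (## (good R c) + ## bad)       ≡⟨ *-distribˡ-+ (2 * k) _ _ ⟩
  2 * k * ## (good R c) + 2 * k * ## bad ≤⟨ +-monoʳ-≤ _ few-bad ⟩
  2 * k * ## (good R c) + n * n          ∎)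
  where
  open ≤-Reasoning
  c = pathConst (2 * k)
  bad : Fin n → Fin n → Bool
  bad x y = R x y ∧ not (does (n * n ≤? c * ## (path₃ R x y)))
  bad⇒R : ∀ x y → bad x y ≡ true → R x y ≡ true
  bad⇒R x y = proj₁ ∘ ∧-true⁻
  eq : ∀ k r → k * r + k * r ≡ 2 * k * r
  eq = solve-∀
  split : ∀ x y → R x y ≡ true → good R c x y ≡ true ⊎ bad x y ≡ true
  split x y e = ∧-split (does (n * n ≤? c * ## (path₃ R x y))) e
    where
    ∧-split : ∀ {a} b → a ≡ true → a ∧ b ≡ true ⊎ a ∧ not b ≡ true
    ∧-split true  refl = inj₁ refl
    ∧-split false refl = inj₂ refl
  not-does⁻ : ∀ {P : Set} (d : Dec P) → not (does d) ≡ true → ¬ P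
  not-does⁻ (no ¬p) _ = ¬p
  few-bad : 2 * k * ## bad ≤ n * n
  few-bad = ≮⇒≥ λ many →
    let x , y , xy-bad , h = edge-with-many-paths bad (2 * k) n>0 (<⇒≤ many)
    in not-does⁻ (n * n ≤? c * ## (path₃ R x y)) (proj₂ (∧-true⁻ {R x y} xy-bad))
         (≤-trans h (*-monoʳ-≤ c (##-mono {R = path₃ bad x y} {S = path₃ R x y} λ x′ y′ e →
            let p , qr = ∧-true⁻ {bad x y′} e
                q , r = ∧-true⁻ {bad x′ y′} qr
            in ∧-true⁺ (bad⇒R x y′ p) (∧-true⁺ (bad⇒R x′ y′ q) (bad⇒R x′ y r)))))

-- Complete bipartite subgraphs of dense relations

*-cancel-large : ∀ k t {c n} → k * t < n → n ≤ k * c → t ≤ c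
*-cancel-large k t {c} lt le = <⇒≤ (*-cancelˡ-< k t c (<-≤-trans lt le))

0<2* : ∀ {k} → 0 < k → 0 < 2 * k
0<2* k>0 = ≤-trans k>0 (m≤m+n _ _)

≤+indicator : ∀ {P : Set} (d : Dec P) {a b c} → (¬ P → a ≤ b) → a ≤ c → a ≤ b + c * ⟦ does d ⟧
≤+indicator (yes _) {b = b} {c} f a≤c = ≤-trans (≤-trans a≤c (≤-reflexive (sym (*-identityʳ c)))) (m≤n+m _ b)
≤+indicator (no ¬p)             f a≤c = ≤-trans (f ¬p) (m≤m+n _ _)

heavy : (Fin n → Fin n → Bool) → ℕ → Fin n → Bool
heavy {n} R k x = does (n ≤? 2 * k * # (allFin n) (R x))

-- Vertices that are not heavy contribute at most `n * n` to `2 * k * ## R`, which is at least twice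
-- as large; the heavy ones supply the rest with degrees at most `n`.
many-heavy : ∀ (R : Fin n → Fin n → Bool) k → 0 < n → n * n ≤ k * ## R → n ≤ 2 * k * # (allFin n) (heavy R k)
many-heavy {n} R k n>0 dense = *-cancelˡ-≤ n {{>-nonZero (n>0)}} (+-cancelˡ-≤ (n * n) _ _ (begin
    n * n + n * n                                        ≤⟨ +-mono-≤ dense dense ⟩
    k * ## R + k * ## R                                  ≡⟨ eq₁ k (## R) ⟩
    2 * k * ## R                                         ≡⟨ ∑-* V (2 * k) _ ⟨
    ∑ V (λ x → 2 * k * # V (R x))                        ≤⟨ ∑-mono V pt ⟩
    ∑ V (λ x → n + 2 * k * n * ⟦ heavy R k x ⟧)              ≡⟨ ∑-+ V _ _ ⟩
    ∑ V (λ _ → n) + ∑ V (λ x → 2 * k * n * ⟦ heavy R k x ⟧)  ≡⟨ cong₂ _+_ (∑-allFin-const n n) (∑-* V (2 * k * n) _) ⟩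
    n * n + 2 * k * n * # V (heavy R k)                        ≡⟨ cong (n * n +_) (eq₂ k n (# V (heavy R k))) ⟩
    n * n + n * (2 * k * # V (heavy R k))                      ∎))
  where
  open ≤-Reasoning
  V = allFin n
  pt : ∀ x → 2 * k * # V (R x) ≤ n + 2 * k * n * ⟦ heavy R k x ⟧
  pt x = ≤+indicator (n ≤? _) ≰⇒≥
    (*-monoʳ-≤ (2 * k) (≤-trans (#≤length V (R x)) (≤-reflexive (length-allFin n))))
  eq₁ : ∀ k r → k * r + k * r ≡ 2 * k * r
  eq₁ = solve-∀
  eq₂ : ∀ k n h → 2 * k * n * h ≡ n * (2 * k * h)
  eq₂ = solve-∀

-- One summand for each use of `pick`: `2 * k * s` heavy vertices outside `F`, then `s` common
-- neighbours outside `F` and the `s` vertices kept on the first side.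
bipartiteBound : ℕ → ℕ → ℕ → ℕ
bipartiteBound k s φ = 2 * k * (2 * k * s + φ) + suc (2 ^ (2 * k * s)) * (s + (s + φ))

-- Kővári–Sós–Turán, with a set F to be avoided.
complete-bipartite : ∀ (R : Fin n → Fin n → Bool) (F : List (Fin n)) k s φ →
  0 < k → length F ≤ φ → bipartiteBound k s φ < n → n * n ≤ k * ## R →
  Σ (Fin s → Fin n) λ f → Σ (Fin s → Fin n) λ g →
    (∀ {i j} → f i ≡ f j → i ≡ j) × (∀ {i j} → g i ≡ g j → i ≡ j) × (∀ i j → f i ≢ g j) ×
    (∀ i → f i ∉ F) × (∀ i → g i ∉ F) × (∀ i j → R (f i) (g j) ≡ true)
complete-bipartite {n} R F k s φ k>0 F≤φ large dense
  with h , h-inj , hp ← pick (2 * k * s) F (heavy R k) (≤-trans (+-monoʳ-≤ (2 * k * s) F≤φ)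
         (*-cancel-large (2 * k) (2 * k * s + φ) (≤-<-trans (m≤m+n _ (suc (2 ^ (2 * k * s)) * (s + (s + φ)))) large)
           (many-heavy R k (≤-<-trans z≤n large) dense)))
  with σ , σ-inj , q , q-dense , _ , qp ← common (allFin n) (2 * k) s (λ j → R (h j))
         (0<2* k>0) (subst (0 <_) (sym (length-allFin n)) (≤-<-trans z≤n large))
         (λ j → subst (_≤ 2 * k * # (allFin n) (R (h j))) (sym (length-allFin n)) (does⁻ (n ≤? _) (proj₁ (hp j))))
  with g , g-inj , gp ← pick s (tabulate (h ∘ σ) ++ F) q (≤-trans (+-monoʳ-≤ s (≤-trans (≤-reflexive
         (trans (length-++ (tabulate (h ∘ σ))) (cong (_+ length F) (length-tabulate (h ∘ σ))))) (+-monoʳ-≤ s F≤φ)))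
         (*-cancel-large (suc (2 ^ (2 * k * s))) (s + (s + φ)) (≤-<-trans (m≤n+m _ (2 * k * (2 * k * s + φ))) large)
           (subst (_≤ suc (2 ^ (2 * k * s)) * # (allFin n) q) (length-allFin n) q-dense)))
  = h ∘ σ , g , σ-inj ∘ h-inj , g-inj
  , (λ i j e → proj₂ (gp j) (∈-++⁺ˡ (subst (_∈ tabulate (h ∘ σ)) e (∈-tabulate⁺ {f = h ∘ σ} i))))
  , (λ i → proj₂ (hp (σ i))) , (λ i → proj₂ (gp i) ∘ ∈-++⁺ʳ (tabulate (h ∘ σ)))
  , (λ i j → qp (g j) (proj₁ (gp j)) i)

-- Matchings and vertex covers

record Matching (R : Fin n → Fin n → Bool) (t : ℕ) : Set where
  field
    l r      : Fin t → Fin n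
    related  : ∀ i → R (l i) (r i) ≡ true
    l-inj    : ∀ {i j} → l i ≡ l j → i ≡ j
    r-inj    : ∀ {i j} → r i ≡ r j → i ≡ j
    disjoint : ∀ i j → l i ≢ r j

  vertices : List (Fin n)
  vertices = tabulate l ++ tabulate r

  length-vertices : length vertices ≡ t + t
  length-vertices = trans (length-++ (tabulate l)) (cong₂ _+_ (length-tabulate l) (length-tabulate r))

Cover : (Fin n → Fin n → Bool) → List (Fin n) → Set
Cover R C = ∀ x y → R x y ≡ true → x ∈ C ⊎ y ∈ C

-- A greedy matching that cannot be extended meets every related pair, so its own vertices form the
-- cover.
matching-or-cover : ∀ (R : Fin n → Fin n → Bool) → (∀ x y → R x y ≡ true → x ≢ y) → ∀ t →
  Matching R t ⊎ Σ (List (Fin n)) λ C → length C ≤ t + t × Cover R C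
matching-or-cover R irr zero = inj₁ record
  { l = λ () ; r = λ () ; related = λ () ; l-inj = λ { {()} } ; r-inj = λ { {()} } ; disjoint = λ () }
matching-or-cover {n} R irr (suc t) with matching-or-cover R irr t
... | inj₂ (C , len , cov) = inj₂ (C , ≤-trans len (+-mono-≤ (n≤1+n t) (n≤1+n t)) , cov)
... | inj₁ M with Fin.any? (λ x → Fin.any? λ y → (R x y Bool.≟ true) ×-dec ¬? (x ∈? Matching.vertices M) ×-dec ¬? (y ∈? Matching.vertices M))
...   | no none = inj₂ (vertices , ≤-trans (≤-reflexive length-vertices) (+-mono-≤ (n≤1+n t) (n≤1+n t)) , cov)
  where
  open Matching M
  cov : Cover R vertices
  cov x y xy with x ∈? vertices | y ∈? vertices
  ... | yes p | _     = inj₁ p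
  ... | no _  | yes q = inj₂ q
  ... | no p  | no q  = ⊥-elim (none (x , y , xy , p , q))
...   | yes (x , y , xy , x∉ , y∉) = inj₁ record
  { l = l′ ; r = r′ ; related = λ { zero → xy ; (suc i) → related i }
  ; l-inj = λ { {zero} {zero} _ → refl
              ; {zero} {suc j} e → ⊥-elim (l≢x j (sym e))
              ; {suc i} {zero} e → ⊥-elim (l≢x i e)
              ; {suc i} {suc j} e → cong suc (l-inj e) }
  ; r-inj = λ { {zero} {zero} _ → refl
              ; {zero} {suc j} e → ⊥-elim (r≢y j (sym e))
              ; {suc i} {zero} e → ⊥-elim (r≢y i e)
              ; {suc i} {suc j} e → cong suc (r-inj e) }
  ; disjoint = λ { zero zero → irr x y xy
                 ; zero (suc j) e → x∉ (subst (_∈ vertices) (sym e) (∈-++⁺ʳ (tabulate l) (∈-tabulate⁺ j)))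
                 ; (suc i) zero e → y∉ (subst (_∈ vertices) e (∈-++⁺ˡ (∈-tabulate⁺ i)))
                 ; (suc i) (suc j) → disjoint i j } }
  where
  open Matching M
  l′ r′ : Fin (suc t) → Fin n
  l′ zero    = x
  l′ (suc i) = l i
  r′ zero    = y
  r′ (suc i) = r i
  l≢x : ∀ i → l i ≢ x
  l≢x i e = x∉ (subst (_∈ vertices) e (∈-++⁺ˡ (∈-tabulate⁺ i)))
  r≢y : ∀ i → r i ≢ y
  r≢y i e = y∉ (subst (_∈ vertices) e (∈-++⁺ʳ (tabulate l) (∈-tabulate⁺ i)))

-- The two configurations

-- By `hyp-inj`, distinct pairs of `Γ` carry distinct hyperedges, so a Berge copy can be built by
-- assigning pairs of `Γ` to the edges of `G`. Pairs are ordered, with a left and a right end; `Γ`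
-- is not symmetric.
record System (H : ThreeGraph n) : Set where
  field
    Γ     : Fin n → Fin n → Bool
    third : Fin n → Fin n → Fin n
    hyp   : Fin n → Fin n → Subset n
    hyp∈        : ∀ {x y} → Γ x y ≡ true → hyp x y ∈ edges H
    left∈       : ∀ {x y} → Γ x y ≡ true → x ∈ₛ hyp x y
    right∈      : ∀ {x y} → Γ x y ≡ true → y ∈ₛ hyp x y
    third∈      : ∀ {x y} → Γ x y ≡ true → third x y ∈ₛ hyp x y
    third≢left  : ∀ {x y} → Γ x y ≡ true → third x y ≢ x
    third≢right : ∀ {x y} → Γ x y ≡ true → third x y ≢ y
    left≢right  : ∀ {x y} → Γ x y ≡ true → x ≢ y
    hyp-inj     : ∀ {x y x′ y′} → Γ x y ≡ true → Γ x′ y′ ≡ true → hyp x y ≡ hyp x′ y′ → x ≡ x′ × y ≡ y′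

-- The covering stars may be centred at right ends; exchanging the sides reduces that case to
-- centres at left ends.
transpose : {H : ThreeGraph n} → System H → System H
transpose S = record
  { Γ = λ x y → Γ y x ; third = λ x y → third y x ; hyp = λ x y → hyp y x
  ; hyp∈ = hyp∈ ; left∈ = right∈ ; right∈ = left∈ ; third∈ = third∈
  ; third≢left = third≢right ; third≢right = third≢left ; left≢right = λ e → left≢right e ∘ sym
  ; hyp-inj = λ e e′ → swap ∘ hyp-inj e e′ }
  where open System S

-- A blow-up of the five-cycle apex, left true, right false, left false,
-- right true in which the first vertex is not blown up.
record Pentagon {H : ThreeGraph n} (S : System H) (s : ℕ) : Set where
  open System S
  field
    apex       : Fin n
    left right : Bool → Fin s → Fin n
    left-inj   : ∀ {b b′ i j} → left b i ≡ left b′ j → b ≡ b′ × i ≡ j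
    right-inj  : ∀ {b b′ i j} → right b i ≡ right b′ j → b ≡ b′ × i ≡ j
    disjoint   : ∀ {b b′ i j} → left b i ≢ right b′ j
    left≢apex  : ∀ {b i} → left b i ≢ apex
    right≢apex : ∀ {b i} → right b i ≢ apex
    -- The hyperedge of a spoke contains `apex` and both ends, yet a Berge copy can use it for one
    -- edge only. The embedding therefore uses at most one end of each spoke as the image of a
    -- vertex.
    spoke      : ∀ i → Γ (left true i) (right true i) ≡ true
    spoke-apex : ∀ i → third (left true i) (right true i) ≡ apex
    rim        : ∀ {b b′} i j → b ∧ b′ ≡ false → Γ (left b i) (right b′ j) ≡ true

-- The hyperedges {aᵢ , bᵢ , yⱼ}: their shadow is a complete bipartite graph
-- with the perfect matching aᵢbᵢ added to one part.
record MatchedBipartite {H : ThreeGraph n} (S : System H) (s t : ℕ) : Set where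
  open System S
  field
    a b   : Fin s → Fin n
    y     : Fin t → Fin n
    a-inj : ∀ {i j} → a i ≡ a j → i ≡ j
    b-inj : ∀ {i j} → b i ≡ b j → i ≡ j
    y-inj : ∀ {i j} → y i ≡ y j → i ≡ j
    a≢b   : ∀ i j → a i ≢ b j
    a≢y   : ∀ i j → a i ≢ y j
    b≢y   : ∀ i j → b i ≢ y j
    edge  : ∀ i j → Γ (a i) (y j) ≡ true
    mate  : ∀ i j → third (a i) (y j) ≡ b i

-- Many disjoint good pairs with the same third vertex

pentagonBound : ℕ → ℕ → ℕ
pentagonBound c s = bipartiteBound (suc (2 ^ (c * s))) s (suc (s + s))

module _ {H : ThreeGraph n} (S : System H) where
  open System S

  goodLink : ℕ → Fin n → Fin n → Fin n → Bool
  goodLink c w x y = good Γ c x y ∧ does (third x y Fin.≟ w)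

  good⇒Γ : ∀ {c x y} → good Γ c x y ≡ true → Γ x y ≡ true
  good⇒Γ {c} {x} {y} = proj₁ ∘ ∧-true⁻ {Γ x y}

  link-dense : ∀ c w {t} (M : Matching (goodLink c w) t) → let open Matching M in ∀ j →
    length (V² n) ≤ c * # (V² n) (λ (x′ , y′) → path₃ Γ (l j) (r j) x′ y′)
  link-dense c w M j = subst₂ _≤_ (sym (length-V² n)) (cong (c *_) (sym (##≡# (path₃ Γ (l j) (r j)))))
    (does⁻ (n * n ≤? _) (proj₂ (∧-true⁻ {Γ (l j) (r j)} (proj₁ (∧-true⁻ {good Γ c (l j) (r j)} (related j))))))
    where open Matching M

  module _ c w {t s} (M : Matching (goodLink c w) t) (σ : Fin s → Fin t) where
    open Matching M

    ends : List (Fin n)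
    ends = w ∷ tabulate (l ∘ σ) ++ tabulate (r ∘ σ)

    length-ends : length ends ≡ suc (s + s)
    length-ends = cong suc (trans (length-++ (tabulate (l ∘ σ))) (cong₂ _+_ (length-tabulate (l ∘ σ)) (length-tabulate (r ∘ σ))))

    assemble-pentagon : (∀ {i j} → σ i ≡ σ j → i ≡ j) → (f g : Fin s → Fin n) →
      (∀ {i j} → f i ≡ f j → i ≡ j) → (∀ {i j} → g i ≡ g j → i ≡ j) → (∀ i j → f i ≢ g j) →
      (∀ i → f i ∉ ends) → (∀ i → g i ∉ ends) →
      (∀ i j k → path₃ Γ (l (σ i)) (r (σ i)) (f j) (g k) ≡ true) → Pentagon S s
    assemble-pentagon σ-inj f g f-inj g-inj f≢g f∉ g∉ path = record
      { apex = w ; left = left ; right = right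
      ; left-inj = left-inj ; right-inj = right-inj ; disjoint = λ {b} {b′} → disj {b} {b′}
      ; left≢apex = λ { {true} {i} e → third≢left (spoke i) (trans (spoke-w i) (sym e))
                      ; {false} {i} e → f∉ i (here e) }
      ; right≢apex = λ { {true} {i} e → third≢right (spoke i) (trans (spoke-w i) (sym e))
                       ; {false} {i} e → g∉ i (here e) }
      ; spoke = spoke
      ; spoke-apex = spoke-w
      ; rim = λ {b} {b′} → rim {b} {b′} }
      where
      left right : Bool → Fin s → Fin n
      left true  = l ∘ σ
      left false = f
      right true  = r ∘ σ
      right false = g
      l∈ends : ∀ i → l (σ i) ∈ ends
      l∈ends i = there (∈-++⁺ˡ (∈-tabulate⁺ {f = l ∘ σ} i))
      r∈ends : ∀ i → r (σ i) ∈ ends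
      r∈ends i = there (∈-++⁺ʳ (tabulate (l ∘ σ)) (∈-tabulate⁺ {f = r ∘ σ} i))
      left-inj : ∀ {b b′ i j} → left b i ≡ left b′ j → b ≡ b′ × i ≡ j
      left-inj {true}  {true}  e = refl , σ-inj (l-inj e)
      left-inj {false} {false} e = refl , f-inj e
      left-inj {true}  {false} {i} {j} e = ⊥-elim (f∉ j (subst (_∈ ends) e (l∈ends i)))
      left-inj {false} {true}  {i} {j} e = ⊥-elim (f∉ i (subst (_∈ ends) (sym e) (l∈ends j)))
      right-inj : ∀ {b b′ i j} → right b i ≡ right b′ j → b ≡ b′ × i ≡ j
      right-inj {true}  {true}  e = refl , σ-inj (r-inj e)
      right-inj {false} {false} e = refl , g-inj e
      right-inj {true}  {false} {i} {j} e = ⊥-elim (g∉ j (subst (_∈ ends) e (r∈ends i)))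
      right-inj {false} {true}  {i} {j} e = ⊥-elim (g∉ i (subst (_∈ ends) (sym e) (r∈ends j)))
      disj : ∀ {b b′ i j} → left b i ≢ right b′ j
      disj {true}  {true}  = disjoint _ _
      disj {false} {false} = f≢g _ _
      disj {true}  {false} {i} {j} e = g∉ j (subst (_∈ ends) e (l∈ends i))
      disj {false} {true}  {i} {j} e = f∉ i (subst (_∈ ends) (sym e) (r∈ends j))
      spoke : ∀ i → Γ (l (σ i)) (r (σ i)) ≡ true
      spoke i = good⇒Γ {c} (proj₁ (∧-true⁻ {good Γ c (l (σ i)) (r (σ i))} (related (σ i))))
      spoke-w : ∀ i → third (l (σ i)) (r (σ i)) ≡ w
      spoke-w i = does⁻ (third (l (σ i)) (r (σ i)) Fin.≟ w) (proj₂ (∧-true⁻ {good Γ c (l (σ i)) (r (σ i))} (related (σ i))))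
      rim : ∀ {b b′} i j → b ∧ b′ ≡ false → Γ (left b i) (right b′ j) ≡ true
      rim {true}  {false} i j _ = proj₁ (∧-true⁻ {Γ (l (σ i)) (g j)} (path i i j))
      rim {false} {false} i j _ = proj₁ (∧-true⁻ {Γ (f i) (g j)} (proj₂ (∧-true⁻ {Γ (l (σ i)) (g j)} (path i i j))))
      rim {false} {true}  i j _ = proj₂ (∧-true⁻ {Γ (f i) (g i)} (proj₂ (∧-true⁻ {Γ (l (σ j)) (g i)} (path j i i))))

  -- Goodness gives each matched pair a set of connecting pairs x′y′ of density at least 1/c. By
  -- `common`, `s` of the `c * s` matched pairs share a dense set `Q` of them. A complete bipartite
  -- graph in `Q`, chosen away from `w` and the ends of the `s` pairs, supplies the two classes
  -- indexed by `false`.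
  pentagon : ∀ c s w → 0 < c → pentagonBound c s < n → Matching (goodLink c w) (c * s) → Pentagon S s
  pentagon c s w c>0 large M = from-common
    (common (V² n) c s paths c>0 (subst (0 <_) (sym (length-V² n)) (*-mono-< n>0 n>0)) (link-dense c w M))
    where
    n>0 : 0 < n
    n>0 = ≤-<-trans z≤n large
    K : ℕ
    K = suc (2 ^ (c * s))
    paths : Fin (c * s) → Fin n × Fin n → Bool
    paths j (x′ , y′) = path₃ Γ (Matching.l M j) (Matching.r M j) x′ y′
    from-common : Common (V² n) K (length (V² n)) s (c * s) (λ _ → true) paths → Pentagon S s
    from-common (σ , σ-inj , q , q-dense , _ , qp) =
      let Q = λ x′ y′ → q (x′ , y′)
          f , g , f-inj , g-inj , f≢g , f∉ , g∉ , fg = complete-bipartite Q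
             (ends c w M σ) K s (suc (s + s)) (s≤s z≤n) (≤-reflexive (length-ends c w M σ)) large
             (subst₂ _≤_ (length-V² n) (cong (K *_) (##≡# Q)) q-dense)
      in assemble-pentagon c w M σ σ-inj f g f-inj g-inj f≢g f∉ g∉ (λ i j k → qp (f j , g k) (fg j k) i)

-- Boundedly many stars for each third vertex

starConst : ℕ → ℕ → ℕ
starConst k D = suc (D * k)

starBound : ℕ → ℕ → ℕ → ℕ
starBound k D s = let K = starConst k D ; T = K * s in
  suc (2 ^ T) * (suc s + (s + s)) + k * (K * (T + T) * suc D)

module _ {H : ThreeGraph n} (S : System H) (G : Fin n → Fin n → Bool) (C : Fin n → List (Fin n)) (k D s : ℕ)
  (G⇒Γ : ∀ {x y} → G x y ≡ true → System.Γ S x y ≡ true)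
  (G⇒∈ : ∀ {x y} → G x y ≡ true → x ∈ C (System.third S x y))
  (C≤D : ∀ w → length (C w) ≤ D)
  (large : starBound k D s < n) where
  open System S
  open ≤-Reasoning

  private
    K T : ℕ
    K = starConst k D
    T = K * s
    V = allFin n

    n>0 : 0 < n
    n>0 = ≤-<-trans z≤n large

    star : Fin n → Fin n → Fin n → Bool
    star x u y = G x y ∧ does (third x y Fin.≟ u)

    star⇒G : ∀ {x u y} → star x u y ≡ true → G x y ≡ true
    star⇒G {x} {u} {y} e = proj₁ (∧-true⁻ {G x y} e)

    star⇒third : ∀ {x u y} → star x u y ≡ true → third x y ≡ u
    star⇒third {x} {u} {y} e = does⁻ (third x y Fin.≟ u) (proj₂ (∧-true⁻ {G x y} e))

    big : Fin n → Fin n → Bool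
    big x u = does (n ≤? K * # V (star x u))

    #>0 : ∀ {p : Fin n → Bool} → 0 < # V p → ∃ λ y → p y ≡ true
    #>0 {p} h =
      let g , _ , gp = pick 1 [] p h
      in g zero , proj₁ (gp zero)

    big-irrefl : ∀ x u → big x u ≡ true → x ≢ u
    big-irrefl x u e refl =
      let y , h = #>0 {star x x} (*-cancelˡ-< K 0 (# V (star x x)) (subst (_< K * # V (star x x)) (sym (*-zeroʳ K))
                    (<-≤-trans n>0 (does⁻ (n ≤? K * # V (star x x)) e))))
      in third≢left (G⇒Γ (star⇒G {x} {x} h)) (star⇒third h)

    -- The matched pairs become the pairs aᵢbᵢ, and `common` finds their shared vertices yⱼ. One
    -- more y than `s` is taken because the embedding reserves one for the matching edges of `G`.
    from-matching : Matching big T → MatchedBipartite S s (suc s)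
    from-matching M = from-common (common V K s (λ j → star (l j) (r j)) (s≤s z≤n) (subst (0 <_) (sym (length-allFin n)) n>0)
      (λ j → subst (_≤ K * # V (star (l j) (r j))) (sym (length-allFin n)) (does⁻ (n ≤? K * # V (star (l j) (r j))) (related j))))
      where
      open Matching M
      from-common : Common V (suc (2 ^ T)) (length V) s T (λ _ → true) (λ j → star (l j) (r j)) → MatchedBipartite S s (suc s)
      from-common (σ , σ-inj , q , q-dense , _ , qp) = from-pick (pick (suc s) F q
        (subst (λ m → suc s + m ≤ # V q) (sym F-length)
          (*-cancel-large (suc (2 ^ T)) (suc s + (s + s)) (≤-<-trans (m≤m+n _ (k * (K * (T + T) * suc D))) large)
            (subst (_≤ suc (2 ^ T) * # V q) (length-allFin n) q-dense))))
        where
        F : List (Fin n)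
        F = tabulate (l ∘ σ) ++ tabulate (r ∘ σ)
        F-length : length F ≡ s + s
        F-length = trans (length-++ (tabulate (l ∘ σ))) (cong₂ _+_ (length-tabulate (l ∘ σ)) (length-tabulate (r ∘ σ)))
        from-pick : (Σ (Fin (suc s) → Fin n) λ g → (∀ {i j} → g i ≡ g j → i ≡ j) × (∀ i → q (g i) ≡ true × g i ∉ F)) →
                    MatchedBipartite S s (suc s)
        from-pick (y , y-inj , yp) = record
          { a = l ∘ σ ; b = r ∘ σ ; y = y
          ; a-inj = σ-inj ∘ l-inj ; b-inj = σ-inj ∘ r-inj ; y-inj = y-inj
          ; a≢b = λ i j → disjoint (σ i) (σ j)
          ; a≢y = λ i j e → proj₂ (yp j) (subst (_∈ F) e (∈-++⁺ˡ (∈-tabulate⁺ {f = l ∘ σ} i)))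
          ; b≢y = λ i j e → proj₂ (yp j) (subst (_∈ F) e (∈-++⁺ʳ (tabulate (l ∘ σ)) (∈-tabulate⁺ {f = r ∘ σ} i)))
          ; edge = λ i j → G⇒Γ (star⇒G {l (σ i)} {r (σ i)} (qp (y j) (proj₁ (yp j)) i))
          ; mate = λ i j → star⇒third (qp (y j) (proj₁ (yp j)) i) }

    module _ (Z : List (Fin n)) (Z≤ : length Z ≤ T + T) (cover : Cover big Z) where
      out : Fin n → ℕ
      out x = ⟦ not (does (x ∈? Z)) ⟧

      inn : Fin n → ℕ
      inn x = ⟦ does (x ∈? Z) ⟧

      pointwise : ∀ x y → ⟦ G x y ⟧ ≤ inn x + ∑ V (λ u → out x * ⟦ star x u y ⟧)
      pointwise x y with G x y in eq | does (x ∈? Z)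
      ... | false | _    = z≤n
      ... | true | true  = s≤s z≤n
      ... | true | false = ≤-trans (≤-reflexive (cong (λ b → ⟦ b ⟧ + 0) (sym (does⁺ (third x y Fin.≟ third x y) refl))))
              (∑-∈ (λ u → ⟦ does (third x y Fin.≟ u) ⟧ + 0) (∈-allFin (third x y)))

      -- For `x` outside `Z`, a nonempty star needs `x ∈ C u`. Then either `u` is in `Z` and the
      -- star is bounded trivially by `n`, or `Z` misses both `x` and `u`, so the pair is not big
      -- and `K` times its star is at most `n`.
      star-bound : ∀ x u → K * (out x * # V (star x u)) ≤ ⟦ does (x ∈? C u) ⟧ * (n + K * n * inn u)
      star-bound x u with x ∈? Z
      ... | yes _ = ≤-trans (≤-reflexive (*-zeroʳ K)) z≤n
      ... | no x∉Z with x ∈? C u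
      ...   | no x∉C = ≤-reflexive (trans (cong (λ m → K * (m + 0)) none) (*-zeroʳ K))
        where
        none : # V (star x u) ≡ 0
        none = n≤0⇒n≡0 (≮⇒≥ λ h → let y , e = #>0 {star x u} h in
          x∉C (subst (λ u′ → x ∈ C u′) (star⇒third {x} {u} {y} e) (G⇒∈ (star⇒G {x} {u} {y} e))))
      ...   | yes _ = ≤-trans (≤-trans (≤-reflexive (cong (K *_) (+-identityʳ (# V (star x u)))))
                (≤+indicator (u ∈? Z) small (*-monoʳ-≤ K (≤-trans (#≤length V (star x u)) (≤-reflexive (length-allFin n))))))
                (m≤m+n _ 0)
        where
        small : u ∉ Z → K * # V (star x u) ≤ n
        small u∉Z = ≮⇒≥ λ h → [ x∉Z , u∉Z ] (cover x u (does⁺ (n ≤? K * # V (star x u)) (<⇒≤ h)))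

      -- Pairs whose left end is in `Z` number at most `n * length Z`. The others are sorted by
      -- their third vertex `u`; each `u` has at most `D` centres, which gives the term with factor
      -- `D` after `star-bound`.
      count : K * ## G ≤ K * (n * length Z) + D * (n * n + K * n * length Z)
      count = begin
        K * ## G ≤⟨ *-monoʳ-≤ K (∑-mono V λ x → ∑-mono V (pointwise x)) ⟩
        K * ∑ V (λ x → ∑ V λ y → inn x + ∑ V (λ u → out x * ⟦ star x u y ⟧))
          ≡⟨ cong (K *_) (trans (∑-cong V λ x → trans (∑-+ V _ _) (cong₂ _+_ (∑-allFin-const n (inn x))
               (trans (∑-swap V V _) (∑-cong V λ u → ∑-* V (out x) _)))) (∑-+ V _ _)) ⟩
        K * (∑ V (λ x → n * inn x) + ∑ V (λ x → ∑ V λ u → out x * # V (star x u)))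
          ≡⟨ *-distribˡ-+ K (∑ V (λ x → n * inn x)) _ ⟩
        K * ∑ V (λ x → n * inn x) + K * ∑ V (λ x → ∑ V λ u → out x * # V (star x u))
          ≡⟨ cong₂ (λ a b → K * a + b) (∑-* V n inn) (trans (sym (∑-* V K _)) (∑-cong V λ x → sym (∑-* V K _))) ⟩
        K * (n * ∑ V inn) + ∑ V (λ x → ∑ V λ u → K * (out x * # V (star x u)))
          ≤⟨ +-mono-≤ (*-monoʳ-≤ K (*-monoʳ-≤ n (#-∈≤length Z))) (∑-mono V λ x → ∑-mono V (star-bound x)) ⟩
        K * (n * length Z) + ∑ V (λ x → ∑ V λ u → ⟦ does (x ∈? C u) ⟧ * (n + K * n * inn u))
          ≡⟨ cong (K * (n * length Z) +_) (trans (∑-swap V V _) (∑-cong V λ u → trans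
               (∑-cong V λ x → *-comm ⟦ does (x ∈? C u) ⟧ _) (∑-* V (n + K * n * inn u) _))) ⟩
        K * (n * length Z) + ∑ V (λ u → (n + K * n * inn u) * # V (λ x → does (x ∈? C u)))
          ≤⟨ +-monoʳ-≤ (K * (n * length Z)) (∑-mono V λ u → *-monoʳ-≤ (n + K * n * inn u) (≤-trans (#-∈≤length (C u)) (C≤D u))) ⟩
        K * (n * length Z) + ∑ V (λ u → (n + K * n * inn u) * D)
          ≡⟨ cong (K * (n * length Z) +_) (trans (∑-cong V λ u → *-comm _ D) (trans (∑-* V D _) (cong (D *_)
               (trans (∑-+ V _ _) (cong₂ _+_ (∑-allFin-const n n) (∑-* V (K * n) inn)))))) ⟩
        K * (n * length Z) + D * (n * n + K * n * ∑ V inn)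
          ≤⟨ +-monoʳ-≤ (K * (n * length Z)) (*-monoʳ-≤ D (+-monoʳ-≤ (n * n) (*-monoʳ-≤ (K * n) (#-∈≤length Z)))) ⟩
        K * (n * length Z) + D * (n * n + K * n * length Z) ∎

      too-few : n * n ≤ k * ## G → ⊥
      too-few dense = <⇒≱ large (begin
        n                                       ≤⟨ *-cancelˡ-≤ n {{>-nonZero n>0}} (+-cancelʳ-≤ (D * k * (n * n)) _ _ (begin
          -- This is why `K` is `suc (D * k)`: the stars that are not big use up only
          -- `D * k * (n * n)`, and the remaining `n * n` must be bounded by a term linear in `n`.
          n * n + D * k * (n * n)                 ≡⟨⟩
          K * (n * n)                             ≤⟨ *-monoʳ-≤ K dense ⟩
          K * (k * ## G)                          ≡⟨ eq₁ K k (## G) ⟩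
          k * (K * ## G)                          ≤⟨ *-monoʳ-≤ k count ⟩
          k * (K * (n * length Z) + D * (n * n + K * n * length Z)) ≡⟨ eq₂ k K n (length Z) D ⟩
          n * (k * (K * length Z * suc D)) + D * k * (n * n) ∎)) ⟩
        k * (K * length Z * suc D)              ≤⟨ *-monoʳ-≤ k (*-monoˡ-≤ (suc D) (*-monoʳ-≤ K Z≤)) ⟩
        k * (K * (T + T) * suc D)               ≤⟨ m≤n+m _ (suc (2 ^ T) * (suc s + (s + s))) ⟩
        starBound k D s                         ∎)
        where
        eq₁ : ∀ K k g → K * (k * g) ≡ k * (K * g)
        eq₁ = solve-∀
        eq₂ : ∀ k K n z D → k * (K * (n * z) + D * (n * n + K * n * z)) ≡ n * (k * (K * z * suc D)) + D * k * (n * n)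
        eq₂ = solve-∀

  matched-bipartite : n * n ≤ k * ## G → MatchedBipartite S s (suc s)
  matched-bipartite dense = [ from-matching , (λ (Z , Z≤ , cover) → ⊥-elim (too-few Z Z≤ cover dense)) ]
    (matching-or-cover big big-irrefl T)

-- The dichotomy

some-or-all : ∀ {P Q : Fin n → Set} → (∀ w → P w ⊎ Q w) → ∃ P ⊎ (∀ w → Q w)
some-or-all {zero}  h = inj₂ λ ()
some-or-all {suc n} h with h zero | some-or-all (h ∘ suc)
... | inj₁ p | _            = inj₁ (zero , p)
... | inj₂ q | inj₁ (w , p) = inj₁ (suc w , p)
... | inj₂ q | inj₂ qs      = inj₂ λ { zero → q ; (suc w) → qs w }

pathConst>0 : ∀ {κ} → 0 < κ → 0 < pathConst κ
pathConst>0 κ>0 = *-mono-< (0<2* (*-mono-< (0<2* κ>0) (0<2* κ>0))) (0<2* (*-mono-< (0<2* κ>0) (0<2* κ>0)))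

-- Passing to good pairs turns 1/k into 1/(2k), and keeping those covered from one side turns this
-- into 1/(4k). A cover coming from a failed matching of size `c * s` has at most `c * s + c * s`
-- vertices.
dichotomyBound : ℕ → ℕ → ℕ
dichotomyBound k s = let c = pathConst (2 * k) in
  pentagonBound c s + starBound (4 * k) (c * s + c * s) s

module _ {H : ThreeGraph n} (S : System H) (k s : ℕ) (k>0 : 0 < k) (large : dichotomyBound k s < n)
         (dense : n * n ≤ k * ## (System.Γ S)) where
  open System S

  private
    c D : ℕ
    c = pathConst (2 * k)
    D = c * s + c * s

    n>0 : 0 < n
    n>0 = ≤-<-trans z≤n large

    Conclusion : Set
    Conclusion = Pentagon S s ⊎ MatchedBipartite S s (suc s) ⊎ MatchedBipartite (transpose S) s (suc s)

    split-dense : ∀ {a b} → n * n ≤ 2 * k * (a + b) → n * n ≤ 4 * k * a ⊎ n * n ≤ 4 * k * b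
    split-dense {a} {b} h with ≤-total a b
    ... | inj₁ a≤b = inj₂ (≤-trans h (≤-trans (*-monoʳ-≤ (2 * k) (+-monoˡ-≤ b a≤b)) (≤-reflexive (eq k b))))
      where
      eq : ∀ k b → 2 * k * (b + b) ≡ 4 * k * b
      eq = solve-∀
    ... | inj₂ b≤a = inj₁ (≤-trans h (≤-trans (*-monoʳ-≤ (2 * k) (+-monoʳ-≤ a b≤a)) (≤-reflexive (eq k a))))
      where
      eq : ∀ k b → 2 * k * (b + b) ≡ 4 * k * b
      eq = solve-∀

    module _ (C : Fin n → List (Fin n)) (C≤D : ∀ w → length (C w) ≤ D) (cover : ∀ w → Cover (goodLink S c w) (C w)) where
      -- The good pairs covered by their left end and those covered by their right end; one of the
      -- two classes holds at least half of the good pairs.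
      G₁ G₂ : Fin n → Fin n → Bool
      G₁ x y = good Γ c x y ∧ does (x ∈? C (third x y))
      G₂ x y = good Γ c x y ∧ does (y ∈? C (third x y))

      covered : ∀ x y → good Γ c x y ≡ true → G₁ x y ≡ true ⊎ G₂ x y ≡ true
      covered x y e with cover (third x y) x y (∧-true⁺ e (does⁺ (third x y Fin.≟ third x y) refl))
      ... | inj₁ x∈ = inj₁ (∧-true⁺ e (does⁺ (x ∈? C (third x y)) x∈))
      ... | inj₂ y∈ = inj₂ (∧-true⁺ e (does⁺ (y ∈? C (third x y)) y∈))

      large′ : starBound (4 * k) D s < n
      large′ = ≤-<-trans (m≤n+m _ (pentagonBound c s)) large

      from-covers : Conclusion
      from-covers = inj₂ ([ left-stars , right-stars ] (split-dense (≤-trans (many-good Γ k n>0 dense)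
        (*-monoʳ-≤ (2 * k) (##-≤+ {R = good Γ c} {S₁ = G₁} {S₂ = G₂} covered)))))
        where
        left-stars : n * n ≤ 4 * k * ## G₁ → MatchedBipartite S s (suc s) ⊎ MatchedBipartite (transpose S) s (suc s)
        left-stars h = inj₁ (matched-bipartite S G₁ C (4 * k) D s
          (λ {x} {y} e → good⇒Γ S {c} (proj₁ (∧-true⁻ {good Γ c x y} e)))
          (λ {x} {y} e → does⁻ (x ∈? C (third x y)) (proj₂ (∧-true⁻ {good Γ c x y} e))) C≤D large′ h)
        right-stars : n * n ≤ 4 * k * ## G₂ → MatchedBipartite S s (suc s) ⊎ MatchedBipartite (transpose S) s (suc s)
        right-stars h = inj₂ (matched-bipartite (transpose S) (λ y x → G₂ x y) C (4 * k) D s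
          (λ {y} {x} e → good⇒Γ S {c} (proj₁ (∧-true⁻ {good Γ c x y} e)))
          (λ {y} {x} e → does⁻ (y ∈? C (third x y)) (proj₂ (∧-true⁻ {good Γ c x y} e))) C≤D large′
          (subst (λ m → n * n ≤ 4 * k * m) (##-transpose G₂) h))

  dichotomy : Conclusion
  dichotomy = [ (λ (w , M) → inj₁ (pentagon S c s w (pathConst>0 (0<2* k>0)) (≤-<-trans (m≤m+n _ _) large) M))
              , (λ q → from-covers (proj₁ ∘ q) (proj₁ ∘ proj₂ ∘ q) (λ w → proj₂ (proj₂ (q w)))) ]
    (some-or-all λ w → matching-or-cover (goodLink S c w)
      (λ x y e → left≢right (good⇒Γ S {c} (proj₁ (∧-true⁻ {good Γ c x y} e)))) (c * s))

-- Embeddings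

SameEdge : (u v u′ v′ : Fin m) → Set
SameEdge u v u′ v′ = (u ≡ u′ × v ≡ v′) ⊎ (u ≡ v′ × v ≡ u′)

-- `slot` names the pair of `Γ` whose hyperedge represents an edge of `G`. As slots are symmetric in
-- the two ends of the edge, it is enough to require the hyperedge to contain the image of the first
-- end.
record Placement (G : SimpleGraph m) {H : ThreeGraph n} (S : System H) (s t : ℕ) : Set where
  open System S
  field
    core     : Fin m → Fin n
    core-inj : ∀ {u v} → core u ≡ core v → u ≡ v
    X        : Fin s → Fin n
    X-inj    : ∀ {i j} → X i ≡ X j → i ≡ j
    Y        : Fin t → Fin n
    Y-inj    : ∀ {i j} → Y i ≡ Y j → i ≡ j
    slot     : Fin m → Fin m → Fin s × Fin t

  carrier : Fin m → Fin m → Subset n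
  carrier u v = let i , j = slot u v in hyp (X i) (Y j)

  field
    slot-Γ    : ∀ u v → Adj G u v → let i , j = slot u v in Γ (X i) (Y j) ≡ true
    slot-sym  : ∀ u v → Adj G u v → slot u v ≡ slot v u
    slot-inj  : ∀ u v u′ v′ → Adj G u v → Adj G u′ v′ → slot u v ≡ slot u′ v′ → SameEdge u v u′ v′
    core∈     : ∀ u v → Adj G u v → core u ∈ₛ carrier u v

  bergeCopy : BergeCopy G H
  bergeCopy = record
    { i = core ; i-inj = core-inj
    ; f = λ u v p → carrier u v , hyp∈ (slot-Γ u v p)
    ; f-sym = λ u v p _ → cong (λ (i , j) → hyp (X i) (Y j)) (slot-sym u v p)
    ; f-inj = λ u v u′ v′ p q e →
        let eX , eY = hyp-inj (slot-Γ u v p) (slot-Γ u′ v′ q) e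
        in slot-inj u v u′ v′ p q (cong₂ _,_ (X-inj eX) (Y-inj eY))
    ; contains = λ u v p → core∈ u v p , subst (λ (i , j) → core v ∈ₛ hyp (X i) (Y j))
        (slot-sym v u (SimpleGraph.sym G p)) (core∈ v u (SimpleGraph.sym G p)) }

-- Embedding into the pentagon

module _ (G : SimpleGraph m) {H : ThreeGraph n} (S : System H) (P : Pentagon S m)
         (triangle-free : TriangleFree G) (v : Fin m) (c : Fin m → Bool)
         (c-proper : ∀ x y → x ≢ v → y ≢ v → Adj G x y → c x ≢ c y) where
  open System S
  open Pentagon P
  open SimpleGraph G using () renaming (sym to Adj-sym)

  private
    -- `v` goes to the apex, its neighbours to the classes indexed by `true`, all other vertices to
    -- those indexed by `false`; the colour chooses between left and right.
    near : Fin m → Bool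
    near u = does (Adj? G v u)

    X Y : Fin m → Fin n
    X u = left (near u) u
    Y u = right (near u) u

    core-by : ∀ {u} → Dec (u ≡ v) → Bool → Fin n
    core-by (yes _)     _     = apex
    core-by {u} (no _)  true  = X u
    core-by {u} (no _)  false = Y u

    core : Fin m → Fin n
    core u = core-by (u Fin.≟ v) (c u)

    core-inj : ∀ {u u′} → core u ≡ core u′ → u ≡ u′
    core-inj {u} {u′} e with u Fin.≟ v | u′ Fin.≟ v | c u | c u′
    ... | yes p | yes q | _     | _     = trans p (sym q)
    ... | yes _ | no _  | _     | true  = ⊥-elim (left≢apex (sym e))
    ... | yes _ | no _  | _     | false = ⊥-elim (right≢apex (sym e))
    ... | no _  | yes _ | true  | _     = ⊥-elim (left≢apex e)
    ... | no _  | yes _ | false | _     = ⊥-elim (right≢apex e)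
    ... | no _  | no _  | true  | true  = proj₂ (left-inj e)
    ... | no _  | no _  | false | false = proj₂ (right-inj e)
    ... | no _  | no _  | true  | false = ⊥-elim (disjoint e)
    ... | no _  | no _  | false | true  = ⊥-elim (disjoint (sym e))

    slot-by : ∀ {u u′} → Dec (u ≡ v) → Dec (u′ ≡ v) → Bool → Fin m × Fin m
    slot-by {u} {u′} (yes _) _       _     = u′ , u′
    slot-by {u} {u′} (no _)  (yes _) _     = u , u
    slot-by {u} {u′} (no _)  (no _)  true  = u , u′
    slot-by {u} {u′} (no _)  (no _)  false = u′ , u

    -- An edge from `v` to `u` takes the spoke with index `u`. An edge avoiding `v` takes the pair
    -- given by its two ends, the one coloured `true` on the left.
    slot : Fin m → Fin m → Fin m × Fin m
    slot u u′ = slot-by (u Fin.≟ v) (u′ Fin.≟ v) (c u)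

    spoke′ : ∀ {u} → Adj G v u → Γ (X u) (Y u) ≡ true
    spoke′ {u} p rewrite does⁺ (Adj? G v u) p = spoke u

    -- Adjacent neighbours of `v` would need a pair between `left true` and `right true` other than
    -- a spoke; they would form a triangle with `v`.
    not-both-near : ∀ {u u′} → Adj G u u′ → near u ∧ near u′ ≡ false
    not-both-near {u} {u′} p with Adj? G v u | Adj? G v u′
    ... | no _  | _     = refl
    ... | yes _ | no _  = refl
    ... | yes a | yes b = ⊥-elim (triangle-free v u u′ a p b)

    slot-Γ : ∀ u u′ → Adj G u u′ → let i , j = slot u u′ in Γ (X i) (Y j) ≡ true
    slot-Γ u u′ p with u Fin.≟ v | u′ Fin.≟ v | c u
    ... | yes refl | _        | _     = spoke′ p
    ... | no _     | yes refl | _     = spoke′ (Adj-sym p)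
    ... | no _     | no _     | true  = rim u u′ (not-both-near p)
    ... | no _     | no _     | false = rim u′ u (not-both-near (Adj-sym p))

    slot-sym : ∀ u u′ → Adj G u u′ → slot u u′ ≡ slot u′ u
    slot-sym u u′ p with u Fin.≟ v | u′ Fin.≟ v | c u in e | c u′ in e′
    ... | yes refl | yes refl | _     | _     = refl
    ... | yes refl | no _     | _     | _     = refl
    ... | no _     | yes refl | _     | _     = refl
    ... | no _     | no _     | true  | false = refl
    ... | no _     | no _     | false | true  = refl
    ... | no a     | no b     | true  | true  = ⊥-elim (c-proper u u′ a b p (trans e (sym e′)))
    ... | no a     | no b     | false | false = ⊥-elim (c-proper u u′ a b p (trans e (sym e′)))

    Adj⇒≢ : ∀ {u u′} → Adj G u u′ → u ≢ u′
    Adj⇒≢ p refl = irrefl G p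

    -- Diagonal slots belong to edges at `v`, off-diagonal slots to the others, and in both kinds
    -- the slot determines the ends of the edge.
    slot-inj : ∀ u w u′ w′ → Adj G u w → Adj G u′ w′ → slot u w ≡ slot u′ w′ → SameEdge u w u′ w′
    slot-inj u w u′ w′ p p′ e
      with u Fin.≟ v | w Fin.≟ v | c u | u′ Fin.≟ v | w′ Fin.≟ v | c u′ | ,-injectiveˡ e | ,-injectiveʳ e
    ... | yes refl | _        | _     | yes refl | _        | _     | refl | _    = inj₁ (refl , refl)
    ... | yes refl | _        | _     | no _     | yes refl | _     | refl | _    = inj₂ (refl , refl)
    ... | yes refl | _        | _     | no _     | no _     | true  | refl | refl = ⊥-elim (Adj⇒≢ p′ refl)
    ... | yes refl | _        | _     | no _     | no _     | false | refl | refl = ⊥-elim (Adj⇒≢ p′ refl)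
    ... | no _     | yes refl | _     | yes refl | _        | _     | refl | _    = inj₂ (refl , refl)
    ... | no _     | yes refl | _     | no _     | yes refl | _     | refl | _    = inj₁ (refl , refl)
    ... | no _     | yes refl | _     | no _     | no _     | true  | refl | refl = ⊥-elim (Adj⇒≢ p′ refl)
    ... | no _     | yes refl | _     | no _     | no _     | false | refl | refl = ⊥-elim (Adj⇒≢ p′ refl)
    ... | no _     | no _     | true  | yes refl | _        | _     | refl | refl = ⊥-elim (Adj⇒≢ p refl)
    ... | no _     | no _     | false | yes refl | _        | _     | refl | refl = ⊥-elim (Adj⇒≢ p refl)
    ... | no _     | no _     | true  | no _     | yes refl | _     | refl | refl = ⊥-elim (Adj⇒≢ p refl)
    ... | no _     | no _     | false | no _     | yes refl | _     | refl | refl = ⊥-elim (Adj⇒≢ p refl)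
    ... | no _     | no _     | true  | no _     | no _     | true  | refl | refl = inj₁ (refl , refl)
    ... | no _     | no _     | true  | no _     | no _     | false | refl | refl = inj₂ (refl , refl)
    ... | no _     | no _     | false | no _     | no _     | true  | refl | refl = inj₂ (refl , refl)
    ... | no _     | no _     | false | no _     | no _     | false | refl | refl = inj₁ (refl , refl)

    spoke-apex′ : ∀ {u} → Adj G v u → third (X u) (Y u) ≡ apex
    spoke-apex′ {u} p rewrite does⁺ (Adj? G v u) p = spoke-apex u

    core∈ : ∀ u u′ → Adj G u u′ → core u ∈ₛ (let i , j = slot u u′ in hyp (X i) (Y j))
    core∈ u u′ p with u Fin.≟ v | u′ Fin.≟ v | c u | slot-Γ u u′ p
    ... | yes refl | _        | _     | γ = subst (_∈ₛ hyp (X u′) (Y u′)) (spoke-apex′ p) (third∈ γ)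
    ... | no _     | yes refl | true  | γ = left∈ γ
    ... | no _     | yes refl | false | γ = right∈ γ
    ... | no _     | no _     | true  | γ = left∈ γ
    ... | no _     | no _     | false | γ = right∈ γ

  pentagon⇒bergeCopy : BergeCopy G H
  pentagon⇒bergeCopy = Placement.bergeCopy {G = G} {S = S} record
    { core = core ; core-inj = core-inj ; X = X ; X-inj = proj₂ ∘ left-inj ; Y = Y ; Y-inj = proj₂ ∘ right-inj
    ; slot = slot ; slot-Γ = slot-Γ ; slot-sym = slot-sym ; slot-inj = slot-inj ; core∈ = core∈ }

-- Embedding into the matched bipartite configuration

module _ (G : SimpleGraph m) {H : ThreeGraph n} (S : System H) (M : MatchedBipartite S m (suc m))
         (triangle-free : TriangleFree G) (c : Fin m → Bool) (s : Bool)
         (inside : ∀ {x y} → Adj G x y → c x ≡ c y → c x ≡ s)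
         (matching : ∀ {x y z} → Adj G x y → c x ≡ c y → Adj G x z → c x ≡ c z → y ≡ z) where
  open System S
  open MatchedBipartite M
  open SimpleGraph G using () renaming (sym to Adj-sym)

  private
    Mate : Fin m → Fin m → Set
    Mate u u′ = Adj G u u′ × c u ≡ c u′

    Mate-sym : ∀ {u u′} → Mate u u′ → Mate u′ u
    Mate-sym (p , e) = Adj-sym p , sym e

    Mate-unique : ∀ {u x y} → Mate u x → Mate u y → x ≡ y
    Mate-unique (p , e) (q , e′) = matching p e q e′

    -- The order on `Fin m` breaks the symmetry of a matching edge: its smaller end `i` goes to
    -- `a i`, the larger one to `b i`, and `i` is the common index. Unmatched vertices of colour `s`
    -- take the a-vertex of their own index.
    lower? : ∀ u → Dec (∃ λ u′ → u′ Fin.< u × Mate u u′)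
    lower? u = Fin.any? λ u′ → u′ Fin.<? u ×-dec Adj? G u u′ ×-dec c u Bool.≟ c u′

    index : Fin m → Fin m
    index u with lower? u
    ... | yes (u′ , _) = u′
    ... | no _         = u

    place : Fin m → Fin n
    place u with lower? u
    ... | yes (u′ , _) = b u′
    ... | no _         = a u

    place-inj : ∀ {u u′} → place u ≡ place u′ → u ≡ u′
    place-inj {u} {u′} e with lower? u | lower? u′
    ... | yes (x , _ , μ) | yes (y , _ , μ′) with refl ← b-inj e = Mate-unique (Mate-sym μ) (Mate-sym μ′)
    ... | yes _ | no _  = ⊥-elim (a≢b _ _ (sym e))
    ... | no _  | yes _ = ⊥-elim (a≢b _ _ e)
    ... | no _  | no _  = a-inj e

    place≢y : ∀ u j → place u ≢ y j
    place≢y u j with lower? u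
    ... | yes _ = b≢y _ j
    ... | no _  = a≢y _ j

    place∈ : ∀ u j → place u ∈ₛ hyp (a (index u)) (y j)
    place∈ u j with lower? u
    ... | yes (u′ , _) = subst (_∈ₛ hyp (a u′) (y j)) (mate u′ j) (third∈ (edge u′ j))
    ... | no _         = left∈ (edge u j)

    index-mate : ∀ {u u′} → Mate u u′ → index u ≡ index u′
    index-mate {u} {u′} μ with lower? u | lower? u′
    ... | yes (x , x<u , ν) | yes (y , y<u′ , ν′)
        with refl ← Mate-unique ν μ | refl ← Mate-unique ν′ (Mate-sym μ) = ⊥-elim (Fin.<-asym x<u y<u′)
    ... | yes (x , _ , ν) | no _ = Mate-unique ν μ
    ... | no _ | yes (y , _ , ν′) = Mate-unique (Mate-sym μ) ν′
    ... | no ¬l | no ¬l′ with Fin.<-cmp u u′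
    ...   | tri< u<u′ _ _ = ⊥-elim (¬l′ (u , u<u′ , Mate-sym μ))
    ...   | tri≈ _ refl _ = refl
    ...   | tri> _ _ u′<u = ⊥-elim (¬l (u′ , u′<u , μ))

    index≡⇒ : ∀ {u u′} → index u ≡ index u′ → u ≡ u′ ⊎ Mate u u′
    index≡⇒ {u} {u′} e with lower? u | lower? u′
    ... | yes (x , _ , ν) | yes (y , _ , ν′) with refl ← e = inj₁ (Mate-unique (Mate-sym ν) (Mate-sym ν′))
    ... | yes (x , _ , ν) | no _ with refl ← e = inj₂ ν
    ... | no _ | yes (y , _ , ν′) with refl ← e = inj₂ (Mate-sym ν′)
    ... | no _ | no _ = inj₁ e

    core-by : ∀ {u} → Dec (c u ≡ s) → Fin n
    core-by {u} (yes _) = place u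
    core-by {u} (no _)  = y (suc u)

    core : Fin m → Fin n
    core u = core-by {u} (c u Bool.≟ s)

    core-inj : ∀ {u u′} → core u ≡ core u′ → u ≡ u′
    core-inj {u} {u′} e with c u Bool.≟ s | c u′ Bool.≟ s
    ... | yes _ | yes _ = place-inj e
    ... | yes _ | no _  = ⊥-elim (place≢y u (suc u′) e)
    ... | no _  | yes _ = ⊥-elim (place≢y u′ (suc u) (sym e))
    ... | no _  | no _  = Fin.suc-injective (y-inj e)

    -- The index 0 on the y side is reserved for the edges of the matching.
    slot-by : ∀ {u u′} → Dec (c u ≡ s) → Dec (c u′ ≡ s) → Fin m × Fin (suc m)
    slot-by {u} {u′} (yes _) (yes _) = index u , zero
    slot-by {u} {u′} (yes _) (no _)  = index u , suc u′
    slot-by {u} {u′} (no _)  _       = index u′ , suc u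

    slot : Fin m → Fin m → Fin m × Fin (suc m)
    slot u u′ = slot-by {u} {u′} (c u Bool.≟ s) (c u′ Bool.≟ s)

    Bool-≢ : ∀ {a b d : Bool} → a ≢ d → b ≢ d → a ≡ b
    Bool-≢ p q = trans (Bool.¬-not p) (sym (Bool.¬-not q))

    slot-sym : ∀ u u′ → Adj G u u′ → slot u u′ ≡ slot u′ u
    slot-sym u u′ p with c u Bool.≟ s | c u′ Bool.≟ s
    ... | yes e | yes e′ = cong (_, zero) (index-mate (p , trans e (sym e′)))
    ... | yes _ | no _   = refl
    ... | no _  | yes _  = refl
    ... | no ne | no ne′ = ⊥-elim (ne (inside p (Bool-≢ ne ne′)))

    -- Two ends of a matching edge share their index, so their edges to one vertex `w` would compete
    -- for the same hyperedge. Such a `w` would complete a triangle.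
    common-nbr : ∀ {u u′ w} → Adj G u w → Adj G u′ w → index u ≡ index u′ → u ≡ u′
    common-nbr p q e with index≡⇒ e
    ... | inj₁ e′ = e′
    ... | inj₂ (μ , _) = ⊥-elim (triangle-free _ _ _ μ q p)

    slot-inj : ∀ u w u′ w′ → Adj G u w → Adj G u′ w′ → slot u w ≡ slot u′ w′ → SameEdge u w u′ w′
    slot-inj u w u′ w′ p p′ e
      with c u Bool.≟ s | c w Bool.≟ s | c u′ Bool.≟ s | c w′ Bool.≟ s | ,-injectiveˡ e | ,-injectiveʳ e
    ... | yes cu | yes cw | yes cu′ | yes cw′ | i≡ | _
        with index≡⇒ i≡
    ...   | inj₁ refl = inj₁ (refl , Mate-unique (p , trans cu (sym cw)) (p′ , trans cu′ (sym cw′)))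
    ...   | inj₂ μ with refl ← Mate-unique μ (p , trans cu (sym cw)) =
              inj₂ (Mate-unique (Mate-sym μ) (p′ , trans cu′ (sym cw′)) , refl)
    slot-inj u w u′ w′ p p′ e | yes _ | no _ | yes _ | no _ | i≡ | refl = inj₁ (common-nbr p p′ i≡ , refl)
    slot-inj u w u′ w′ p p′ e | yes _ | no _ | no _  | _    | i≡ | refl = inj₂ (common-nbr p (Adj-sym p′) i≡ , refl)
    slot-inj u w u′ w′ p p′ e | no _  | _    | yes _ | no _ | i≡ | refl = inj₂ (refl , common-nbr (Adj-sym p) p′ i≡)
    slot-inj u w u′ w′ p p′ e | no _  | _    | no _  | _    | i≡ | refl = inj₁ (refl , common-nbr (Adj-sym p) (Adj-sym p′) i≡)

    core∈ : ∀ u u′ → Adj G u u′ → core u ∈ₛ (let i , j = slot u u′ in hyp (a i) (y j))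
    core∈ u u′ p with c u Bool.≟ s | c u′ Bool.≟ s
    ... | yes _ | yes _ = place∈ u zero
    ... | yes _ | no _  = place∈ u (suc u′)
    ... | no _  | _     = right∈ (edge _ _)

  matchedBipartite⇒bergeCopy : BergeCopy G H
  matchedBipartite⇒bergeCopy = Placement.bergeCopy {G = G} {S = S} record
    { core = core ; core-inj = core-inj ; X = a ; X-inj = a-inj ; Y = y ; Y-inj = y-inj
    ; slot = slot ; slot-Γ = λ u u′ _ → edge _ _ ; slot-sym = slot-sym ; slot-inj = slot-inj ; core∈ = core∈ }

-- From a dense shadow to a system

∑-filter : ∀ {P : A → Set} (P? : Decidable P) (xs : List A) (f : A → ℕ) →
           ∑ (filter P? xs) f ≡ ∑ xs (λ a → ⟦ does (P? a) ⟧ * f a)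
∑-filter P? []       f = refl
∑-filter P? (x ∷ xs) f with does (P? x)
... | false = ∑-filter P? xs f
... | true  = cong₂ _+_ (sym (+-identityʳ (f x))) (∑-filter P? xs f)

∑-concatMap : ∀ (g : A → List B) (xs : List A) (f : B → ℕ) →
              ∑ (concatMap g xs) f ≡ ∑ xs (λ a → ∑ (g a) f)
∑-concatMap g []       f = refl
∑-concatMap g (x ∷ xs) f = trans (cong sum (map-++ f (g x) _))
  (trans (sum-++ (map f (g x)) _) (cong (∑ (g x) f +_) (∑-concatMap g xs f)))

inShadow : ThreeGraph n → Fin n → Fin n → Bool
inShadow H x y = does (x Fin.<? y) ∧ does (inShadow? H (x , y))

shadowSize≡## : ∀ (H : ThreeGraph n) → shadowSize H ≡ ## (inShadow H)
shadowSize≡## {n} H = begin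
  length (filter (inShadow? H) (pairs n))                  ≡⟨ trans (∑-const (filter (inShadow? H) (pairs n)) 1) (*-identityʳ _) ⟨
  ∑ (filter (inShadow? H) (pairs n)) (λ _ → 1)             ≡⟨ ∑-filter (inShadow? H) (pairs n) _ ⟩
  ∑ (pairs n) (λ p → ⟦ does (inShadow? H p) ⟧ * 1)         ≡⟨ ∑-cong (pairs n) (λ p → *-identityʳ _) ⟩
  ∑ (pairs n) (λ p → ⟦ does (inShadow? H p) ⟧)             ≡⟨ ∑-concatMap _ V _ ⟩
  ∑ V (λ x → ∑ (map (x ,_) (filter (λ y → x Fin.<? y) V)) (λ p → ⟦ does (inShadow? H p) ⟧))
    ≡⟨ ∑-cong V (λ x → trans (cong sum (sym (map-∘ (filter (λ y → x Fin.<? y) V)))) (∑-filter (λ y → x Fin.<? y) V _)) ⟩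
  ∑ V (λ x → ∑ V (λ y → ⟦ does (x Fin.<? y) ⟧ * ⟦ does (inShadow? H (x , y)) ⟧))
    ≡⟨ ∑-cong V (λ x → ∑-cong V λ y → ⟦∧⟧ (does (x Fin.<? y)) _) ⟨
  ## (inShadow H) ∎
  where
  open ≡-Reasoning
  V = allFin n

2*nC2+n≡n*n : ∀ n → 2 * (n choose 2) + n ≡ n * n
2*nC2+n≡n*n zero    = refl
2*nC2+n≡n*n (suc n) = begin
  2 * (suc n choose 2) + suc n      ≡⟨ cong (λ c → 2 * c + suc n) (sym (nCk+nC[k+1]≡[n+1]C[k+1] n 1)) ⟩
  2 * (n choose 1 + n choose 2) + suc n  ≡⟨ cong (λ c → 2 * (c + n choose 2) + suc n) (nC1≡n n) ⟩
  2 * (n + n choose 2) + suc n      ≡⟨ eq₁ n (n choose 2) ⟩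
  (2 * (n choose 2) + n) + (n + suc n) ≡⟨ cong (_+ (n + suc n)) (2*nC2+n≡n*n n) ⟩
  n * n + (n + suc n)          ≡⟨ eq₂ n ⟩
  suc n * suc n                ∎
  where
  open ≡-Reasoning
  eq₁ : ∀ n c → 2 * (n + c) + suc n ≡ (2 * c + n) + (n + suc n)
  eq₁ = solve-∀
  eq₂ : ∀ n → n * n + (n + suc n) ≡ suc n * suc n
  eq₂ = solve-∀

-- Hyperedges with three vertices

∣p∪q∣≤∣p∣+∣q∣ : ∀ (p q : Subset n) → ∣ p ∪ q ∣ ≤ ∣ p ∣ + ∣ q ∣
∣p∪q∣≤∣p∣+∣q∣ []          []          = z≤n
∣p∪q∣≤∣p∣+∣q∣ (false ∷ p) (false ∷ q) = ∣p∪q∣≤∣p∣+∣q∣ p q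
∣p∪q∣≤∣p∣+∣q∣ (false ∷ p) (true ∷ q)  = ≤-trans (s≤s (∣p∪q∣≤∣p∣+∣q∣ p q)) (≤-reflexive (sym (+-suc ∣ p ∣ ∣ q ∣)))
∣p∪q∣≤∣p∣+∣q∣ (true ∷ p)  (false ∷ q) = s≤s (∣p∪q∣≤∣p∣+∣q∣ p q)
∣p∪q∣≤∣p∣+∣q∣ (true ∷ p)  (true ∷ q)  = s≤s (≤-trans (∣p∪q∣≤∣p∣+∣q∣ p q) (+-monoʳ-≤ ∣ p ∣ (n≤1+n ∣ q ∣)))

module _ {e : Subset n} (∣e∣≡3 : ∣ e ∣ ≡ 3) where

  third-vertex : ∀ x y → ∃ λ w → w ∈ₛ e × w ≢ x × w ≢ y
  third-vertex x y with Fin.any? (λ w → w Subset.∈? e ×-dec ¬? (w Fin.≟ x) ×-dec ¬? (w Fin.≟ y))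
  ... | yes p = p
  ... | no ¬p = ⊥-elim (<⇒≱ (subst (2 <_) (sym ∣e∣≡3) ≤-refl) (≤-trans (Subset.p⊆q⇒∣p∣≤∣q∣ e⊆)
          (≤-trans (∣p∪q∣≤∣p∣+∣q∣ ⁅ x ⁆ ⁅ y ⁆) (≤-reflexive (cong₂ _+_ (Subset.∣⁅x⁆∣≡1 x) (Subset.∣⁅x⁆∣≡1 y))))))
    where
    e⊆ : ∀ {w} → w ∈ₛ e → w ∈ₛ ⁅ x ⁆ ∪ ⁅ y ⁆
    e⊆ {w} w∈ with w Fin.≟ x | w Fin.≟ y
    ... | yes refl | _        = Subset.x∈p∪q⁺ (inj₁ (Subset.x∈⁅x⁆ x))
    ... | no _     | yes refl = Subset.x∈p∪q⁺ (inj₂ (Subset.x∈⁅x⁆ y))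
    ... | no a     | no b     = ⊥-elim (¬p (w , w∈ , a , b))

  no-fourth : ∀ {a b c z} → a ∈ₛ e → b ∈ₛ e → c ∈ₛ e → b ≢ a → c ≢ a → c ≢ b → z ∈ₛ e → z ≡ a ⊎ z ≡ b ⊎ z ≡ c
  no-fourth {a} {b} {c} {z} a∈ b∈ c∈ b≢a c≢a c≢b z∈ with z Fin.≟ a | z Fin.≟ b | z Fin.≟ c
  ... | yes p | _     | _     = inj₁ p
  ... | no _  | yes p | _     = inj₂ (inj₁ p)
  ... | no _  | no _  | yes p = inj₂ (inj₂ p)
  ... | no z≢a | no z≢b | no z≢c = ⊥-elim (<⇒≱ 3<∣e∣ (≤-reflexive ∣e∣≡3))
    where
    _∈∖_ = Subset.x∈p∧x≢y⇒x∈p-y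
    shrink = Subset.x∈p⇒∣p-x∣<∣p∣
    3<∣e∣ : 3 < ∣ e ∣
    3<∣e∣ = ≤-<-trans (≤-<-trans (≤-<-trans (≤-<-trans z≤n (shrink (((z∈ ∈∖ z≢a) ∈∖ z≢b) ∈∖ z≢c)))
      (shrink ((c∈ ∈∖ c≢a) ∈∖ c≢b))) (shrink (b∈ ∈∖ b≢a))) (shrink a∈)

  Sorted : Fin n → Fin n → Fin n → Set
  Sorted a b c = (a ∈ₛ e × b ∈ₛ e × c ∈ₛ e) × a Fin.< b × b Fin.< c

  sorted-member : ∀ {a b c z} → Sorted a b c → z ∈ₛ e → z ≡ a ⊎ z ≡ b ⊎ z ≡ c
  sorted-member ((a∈ , b∈ , c∈) , a<b , b<c) = no-fourth a∈ b∈ c∈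
    (Fin.<⇒≢ a<b ∘ sym) (Fin.<⇒≢ (Fin.<-trans a<b b<c) ∘ sym) (Fin.<⇒≢ b<c ∘ sym)

  sorted-min : ∀ {a b c z} → Sorted a b c → z ∈ₛ e → a Fin.≤ z
  sorted-min S@(_ , a<b , b<c) z∈ with sorted-member S z∈
  ... | inj₁ refl        = ≤-refl
  ... | inj₂ (inj₁ refl) = <⇒≤ a<b
  ... | inj₂ (inj₂ refl) = <⇒≤ (<-trans a<b b<c)

  sorted-max : ∀ {a b c z} → Sorted a b c → z ∈ₛ e → z Fin.≤ c
  sorted-max S@(_ , a<b , b<c) z∈ with sorted-member S z∈
  ... | inj₁ refl        = <⇒≤ (<-trans a<b b<c)
  ... | inj₂ (inj₁ refl) = <⇒≤ b<c
  ... | inj₂ (inj₂ refl) = ≤-refl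

  -- The outer entries are the minimum and the maximum of `e`, and only one member is left for the
  -- middle.
  sorted-unique : ∀ {a b c a′ b′ c′} → Sorted a b c → Sorted a′ b′ c′ → a ≡ a′ × b ≡ b′ × c ≡ c′
  sorted-unique S@((a∈ , b∈ , c∈) , a<b , b<c) S′@((a∈′ , b∈′ , c∈′) , a<b′ , b<c′)
    with refl ← Fin.≤-antisym (sorted-min S a∈′) (sorted-min S′ a∈)
    with refl ← Fin.≤-antisym (sorted-max S′ c∈) (sorted-max S c∈′)
    with sorted-member S b∈′
  ... | inj₁ refl        = ⊥-elim (<-irrefl refl a<b′)
  ... | inj₂ (inj₁ refl) = refl , refl , refl
  ... | inj₂ (inj₂ refl) = ⊥-elim (<-irrefl refl b<c′)

-- Choosing distinct hyperedges for shadow pairs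

module _ (H : ThreeGraph n) where

  record Witness (x y : Fin n) (e : Subset n) (w : Fin n) : Set where
    constructor witness
    field
      x<y : x Fin.< y
      e∈  : e ∈ edges H
      x∈  : x ∈ₛ e
      y∈  : y ∈ₛ e
      w∈  : w ∈ₛ e
      w≢x : w ≢ x
      w≢y : w ≢ y

    size : ∣ e ∣ ≡ 3
    size = All.lookup (size3 H) e∈

  find-witness : ∀ x y → Dec (x Fin.< y) → Dec (InShadow H x y) → Subset n × Fin n
  find-witness x y (yes _) (yes p) =
    let e , e∈ , _ = find p
        w , _ = third-vertex {e = e} (All.lookup (size3 H) e∈) x y
    in e , w
  find-witness x y _ _ = Subset.⊥ , x

  chosen : Fin n → Fin n → Subset n × Fin n
  chosen x y = find-witness x y (x Fin.<? y) (inShadow? H (x , y))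

  hyp : Fin n → Fin n → Subset n
  hyp x y = proj₁ (chosen x y)

  third : Fin n → Fin n → Fin n
  third x y = proj₂ (chosen x y)

  chosen-correct : ∀ x y → inShadow H x y ≡ true → Witness x y (hyp x y) (third x y)
  chosen-correct x y = go (x Fin.<? y) (inShadow? H (x , y))
    where
    go : (d : Dec (x Fin.< y)) (d′ : Dec (InShadow H x y)) → does d ∧ does d′ ≡ true →
         Witness x y (proj₁ (find-witness x y d d′)) (proj₂ (find-witness x y d d′))
    go (yes x<y) (yes p) _ =
      let e , e∈ , x∈ , y∈ = find p
          w , w∈ , w≢x , w≢y = third-vertex {e = e} (All.lookup (size3 H) e∈) x y
      in witness x<y e∈ x∈ y∈ w∈ w≢x w≢y

  -- The position of the third vertex in the sorted hyperedge: for each of the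
  -- three positions, a hyperedge determines the pair that chose it.
  low mid high : Fin n → Fin n → Bool
  low  x y = inShadow H x y ∧ does (third x y Fin.<? x)
  mid  x y = inShadow H x y ∧ does (x Fin.<? third x y) ∧ does (third x y Fin.<? y)
  high x y = inShadow H x y ∧ does (y Fin.<? third x y)

  positions : ∀ x y → inShadow H x y ≡ true → low x y ≡ true ⊎ mid x y ≡ true ⊎ high x y ≡ true
  positions x y e with Fin.<-cmp (third x y) x | Fin.<-cmp (third x y) y
  ... | tri< lt _ _ | _ = inj₁ (∧-true⁺ e (does⁺ (third x y Fin.<? x) lt))
  ... | tri≈ _ eq _ | _ = ⊥-elim (Witness.w≢x (chosen-correct x y e) eq)
  ... | tri> _ _ gt | tri< lt _ _ = inj₂ (inj₁ (∧-true⁺ e (∧-true⁺ (does⁺ (x Fin.<? third x y) gt) (does⁺ (third x y Fin.<? y) lt))))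
  ... | tri> _ _ gt | tri≈ _ eq _ = ⊥-elim (Witness.w≢y (chosen-correct x y e) eq)
  ... | tri> _ _ gt | tri> _ _ gt′ = inj₂ (inj₂ (∧-true⁺ e (does⁺ (y Fin.<? third x y) gt′)))

  system : (Γ : Fin n → Fin n → Bool) → (∀ {x y} → Γ x y ≡ true → inShadow H x y ≡ true) →
    (∀ {x y x′ y′} → Γ x y ≡ true → Γ x′ y′ ≡ true → hyp x y ≡ hyp x′ y′ → x ≡ x′ × y ≡ y′) → System H
  system Γ Γ⇒ inj = record
    { Γ = Γ ; third = third ; hyp = hyp
    ; hyp∈ = e∈ ∘ W ; left∈ = x∈ ∘ W ; right∈ = y∈ ∘ W ; third∈ = w∈ ∘ W
    ; third≢left = w≢x ∘ W ; third≢right = w≢y ∘ W ; left≢right = Fin.<⇒≢ ∘ x<y ∘ W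
    ; hyp-inj = inj }
    where
    open Witness
    W : ∀ {x y} → Γ x y ≡ true → Witness x y (hyp x y) (third x y)
    W {x} {y} e = chosen-correct x y (Γ⇒ e)

  low-system mid-system high-system : System H
  low-system = system low (λ {x} {y} e → proj₁ (∧-true⁻ {inShadow H x y} e)) λ {x} {y} {x′} {y′} e e′ h≡ →
    let s , p = ∧-true⁻ {inShadow H x y} e
        s′ , p′ = ∧-true⁻ {inShadow H x′ y′} e′
        W = chosen-correct x y s
        W′ = chosen-correct x′ y′ s′
        open Witness
        _ , x≡ , y≡ = sorted-unique (size W)
          ((w∈ W , x∈ W , y∈ W) , does⁻ (third x y Fin.<? x) p , x<y W)
          (subst (λ z → (third x′ y′ ∈ₛ z × x′ ∈ₛ z × y′ ∈ₛ z) × third x′ y′ Fin.< x′ × x′ Fin.< y′) (sym h≡)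
            ((w∈ W′ , x∈ W′ , y∈ W′) , does⁻ (third x′ y′ Fin.<? x′) p′ , x<y W′))
    in x≡ , y≡
  mid-system = system mid (λ {x} {y} e → proj₁ (∧-true⁻ {inShadow H x y} e)) λ {x} {y} {x′} {y′} e e′ h≡ →
    let s , pq = ∧-true⁻ {inShadow H x y} e
        s′ , pq′ = ∧-true⁻ {inShadow H x′ y′} e′
        p , q = ∧-true⁻ {does (x Fin.<? third x y)} pq
        p′ , q′ = ∧-true⁻ {does (x′ Fin.<? third x′ y′)} pq′
        W = chosen-correct x y s
        W′ = chosen-correct x′ y′ s′
        open Witness
        x≡ , _ , y≡ = sorted-unique (size W)
          ((x∈ W , w∈ W , y∈ W) , does⁻ (x Fin.<? third x y) p , does⁻ (third x y Fin.<? y) q)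
          (subst (λ z → (x′ ∈ₛ z × third x′ y′ ∈ₛ z × y′ ∈ₛ z) × x′ Fin.< third x′ y′ × third x′ y′ Fin.< y′) (sym h≡)
            ((x∈ W′ , w∈ W′ , y∈ W′) , does⁻ (x′ Fin.<? third x′ y′) p′ , does⁻ (third x′ y′ Fin.<? y′) q′))
    in x≡ , y≡
  high-system = system high (λ {x} {y} e → proj₁ (∧-true⁻ {inShadow H x y} e)) λ {x} {y} {x′} {y′} e e′ h≡ →
    let s , p = ∧-true⁻ {inShadow H x y} e
        s′ , p′ = ∧-true⁻ {inShadow H x′ y′} e′
        W = chosen-correct x y s
        W′ = chosen-correct x′ y′ s′
        open Witness
        x≡ , y≡ , _ = sorted-unique (size W)
          ((x∈ W , y∈ W , w∈ W) , x<y W , does⁻ (y Fin.<? third x y) p)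
          (subst (λ z → (x′ ∈ₛ z × y′ ∈ₛ z × third x′ y′ ∈ₛ z) × x′ Fin.< y′ × y′ Fin.< third x′ y′) (sym h≡)
            ((x∈ W′ , y∈ W′ , w∈ W′) , x<y W′ , does⁻ (y′ Fin.<? third x′ y′) p′))
    in x≡ , y≡

  shadow-split : shadowSize H ≤ ## low + (## mid + ## high)
  shadow-split = begin
    shadowSize H                              ≡⟨ shadowSize≡## H ⟩
    ## (inShadow H)                           ≤⟨ ##-≤+ {R = inShadow H} {S₁ = low} {S₂ = λ x y → mid x y ∨ high x y}
                                                   (λ x y e → Sum.map₂ (∨-true⁺ (mid x y)) (positions x y e)) ⟩
    ## low + ## (λ x y → mid x y ∨ high x y)  ≤⟨ +-monoʳ-≤ (## low) (##-≤+ {S₁ = mid} {S₂ = high} λ x y → ∨-true⁻ (mid x y)) ⟩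
    ## low + (## mid + ## high)               ∎
    where
    open ≤-Reasoning
    ∨-true⁺ : ∀ a {b} → a ≡ true ⊎ b ≡ true → a ∨ b ≡ true
    ∨-true⁺ true  _         = refl
    ∨-true⁺ false (inj₂ b≡) = b≡
    ∨-true⁻ : ∀ a {b} → a ∨ b ≡ true → a ≡ true ⊎ b ≡ true
    ∨-true⁻ true  _  = inj₁ refl
    ∨-true⁻ false b≡ = inj₂ b≡

  dense-system : ∃ λ (S : System H) → shadowSize H ≤ 3 * ## (System.Γ S)
  dense-system = choose (pigeonhole {a = ## low} {## mid} {## high} shadow-split)
    where
    choose : shadowSize H ≤ 3 * ## low ⊎ shadowSize H ≤ 3 * ## mid ⊎ shadowSize H ≤ 3 * ## high →
             ∃ λ (S : System H) → shadowSize H ≤ 3 * ## (System.Γ S)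
    choose (inj₁ h)        = low-system , h
    choose (inj₂ (inj₁ h)) = mid-system , h
    choose (inj₂ (inj₂ h)) = high-system , h
    pigeonhole : ∀ {N a b c} → N ≤ a + (b + c) → N ≤ 3 * a ⊎ N ≤ 3 * b ⊎ N ≤ 3 * c
    pigeonhole {N} {a} {b} {c} h with ≤-total a b | ≤-total a c | ≤-total b c
    ... | inj₁ a≤b | _        | inj₂ c≤b = inj₂ (inj₁ (≤-trans h (+-mono-≤ a≤b (+-monoʳ-≤ b (≤-trans c≤b (m≤m+n b 0))))))
    ... | _        | inj₁ a≤c | inj₁ b≤c = inj₂ (inj₂ (≤-trans h (+-mono-≤ a≤c (+-mono-≤ b≤c (m≤m+n c 0)))))
    ... | inj₂ b≤a | inj₂ c≤a | _        = inj₁ (≤-trans h (+-monoʳ-≤ a (+-mono-≤ b≤a (≤-trans c≤a (m≤m+n a 0)))))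
    ... | inj₁ a≤b | inj₂ c≤a | inj₁ b≤c = inj₂ (inj₂ (≤-trans h (+-mono-≤ (≤-trans a≤b b≤c) (+-mono-≤ b≤c (m≤m+n c 0)))))
    ... | inj₂ b≤a | inj₁ a≤c | inj₂ c≤b = inj₂ (inj₁ (≤-trans h (+-mono-≤ (≤-trans a≤c c≤b) (+-monoʳ-≤ b (≤-trans c≤b (m≤m+n b 0))))))

-- Since n² is twice the binomial coefficient plus n, 2n² is four times that coefficient plus 2n.
-- The factor 3 from `dense-system` turns 4 into 12, and `2 ≤ n` absorbs 2n into one n².
large-shadow : ∀ k {n} (H : ThreeGraph n) → 2 ≤ n → n choose 2 < k * shadowSize H →
               ∃ λ (S : System H) → n * n ≤ 12 * k * ## (System.Γ S)
large-shadow k {n} H 2≤n dense = S , +-cancelʳ-≤ (n * n) _ _ (begin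
  n * n + n * n                          ≡⟨ cong (λ z → z + z) (2*nC2+n≡n*n n) ⟨
  (2 * (n choose 2) + n) + (2 * (n choose 2) + n)  ≡⟨ eq₁ (n choose 2) n ⟩
  4 * (n choose 2) + 2 * n                    ≤⟨ +-mono-≤ (*-monoʳ-≤ 4 (≤-trans (<⇒≤ dense) (*-monoʳ-≤ k bound))) (*-monoˡ-≤ n 2≤n) ⟩
  4 * (k * (3 * ## Γ)) + n * n           ≡⟨ cong (_+ n * n) (eq₂ k (## Γ)) ⟩
  12 * k * ## Γ + n * n                  ∎)
  where
  open ≤-Reasoning
  S = proj₁ (dense-system H)
  bound = proj₂ (dense-system H)
  open System S using (Γ)
  eq₁ : ∀ c n → (2 * c + n) + (2 * c + n) ≡ 4 * c + 2 * n
  eq₁ = solve-∀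
  eq₂ : ∀ k g → 4 * (k * (3 * g)) ≡ 12 * k * g
  eq₂ = solve-∀

-- The two conditions suffice

sufficiency : ∀ (G : SimpleGraph m) → Condition1 G × Condition2 G → PiHat3Zero G
sufficiency {m} G ((triangle-free , v , c , c-proper) , (d , B , _ , _ , B-proper , s , inside , matching)) k k>0 =
  2 + dichotomyBound (12 * k) m , λ n N≤n H free → ≮⇒≥ λ dense →
    let S , S-dense = large-shadow k H (≤-trans (m≤m+n 2 _) N≤n) dense
    in free ([ (λ P → pentagon⇒bergeCopy G S P triangle-free v c c-proper)
             , [ from-matched H S , from-matched H (transpose S) ] ]
         (dichotomy S (12 * k) m (≤-trans k>0 (m≤m+n k _)) (≤-trans (n≤1+n _) N≤n) S-dense))
  where
  -- A monochromatic pair cannot belong to `B`, so condition (2) applies to every monochromatic edge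
  -- without having to decide `B`.
  ¬B : ∀ {x y} → d x ≡ d y → ¬ B x y
  ¬B e b = B-proper _ _ b e
  from-matched : ∀ {n} (H : ThreeGraph n) (S : System H) → MatchedBipartite S m (suc m) → BergeCopy G H
  from-matched H S M = matchedBipartite⇒bergeCopy G S M triangle-free d s
    (λ p e → proj₁ (inside _ _ p (¬B e))) (λ p e q e′ → matching _ _ _ p (¬B e) q (¬B e′))

-- Lower bound constructions

∣p++q∣≡∣p∣+∣q∣ : ∀ (p : Subset m) (q : Subset n) → ∣ p ++ᵛ q ∣ ≡ ∣ p ∣ + ∣ q ∣
∣p++q∣≡∣p∣+∣q∣ []          q = refl
∣p++q∣≡∣p∣+∣q∣ (false ∷ p) q = ∣p++q∣≡∣p∣+∣q∣ p q
∣p++q∣≡∣p∣+∣q∣ (true ∷ p)  q = cong suc (∣p++q∣≡∣p∣+∣q∣ p q)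

⁅⁆-injective : ∀ {i j : Fin n} → ⁅ i ⁆ ≡ ⁅ j ⁆ → i ≡ j
⁅⁆-injective {i = i} {j} e = Subset.x∈⁅y⁆⇒x≡y j (subst (i ∈ₛ_) e (Subset.x∈⁅x⁆ i))

∈-++ˡ : ∀ (p : Subset m) (q : Subset n) {i} → i ∈ₛ p → (i ↑ˡ n) ∈ₛ (p ++ᵛ q)
∈-++ˡ p q {i} i∈ = lookup⇒[]= (i ↑ˡ _) (p ++ᵛ q) (trans (lookup-++ˡ p q i) ([]=⇒lookup i∈))

∈-++ʳ : ∀ (p : Subset m) (q : Subset n) {i} → i ∈ₛ q → (m ↑ʳ i) ∈ₛ (p ++ᵛ q)
∈-++ʳ {m} p q {i} i∈ = lookup⇒[]= (m ↑ʳ i) (p ++ᵛ q) (trans (lookup-++ʳ p q i) ([]=⇒lookup i∈))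

∈-++⁻ : ∀ (p : Subset m) (q : Subset n) {v} → v ∈ₛ (p ++ᵛ q) →
        (∃ λ i → v ≡ i ↑ˡ n × i ∈ₛ p) ⊎ (∃ λ i → v ≡ m ↑ʳ i × i ∈ₛ q)
∈-++⁻ {m} {n} p q {v} v∈ with splitAt m v in eq
... | inj₁ i with refl ← Fin.splitAt⁻¹-↑ˡ eq = inj₁ (i , refl , lookup⇒[]= i p (trans (sym (lookup-++ˡ p q i)) ([]=⇒lookup v∈)))
... | inj₂ i with refl ← Fin.splitAt⁻¹-↑ʳ {m} eq = inj₂ (i , refl , lookup⇒[]= i q (trans (sym (lookup-++ʳ p q i)) ([]=⇒lookup v∈)))

∑-allFin-+ : ∀ m n (f : Fin (m + n) → ℕ) →
  ∑ (allFin (m + n)) f ≡ ∑ (allFin m) (λ i → f (i ↑ˡ n)) + ∑ (allFin n) (λ i → f (m ↑ʳ i))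
∑-allFin-+ zero    n f = refl
∑-allFin-+ (suc m) n f = begin
  ∑ (allFin (suc m + n)) f                   ≡⟨ ∑-allFin-suc (m + n) f ⟩
  f zero + ∑ (allFin (m + n)) (f ∘ suc)      ≡⟨ cong (f zero +_) (∑-allFin-+ m n (f ∘ suc)) ⟩
  f zero + (∑ (allFin m) (λ i → f (suc (i ↑ˡ n))) + ∑ (allFin n) (λ i → f (suc (m ↑ʳ i)))) ≡⟨ +-assoc (f zero) _ _ ⟨
  f zero + ∑ (allFin m) (λ i → f (suc (i ↑ˡ n))) + ∑ (allFin n) (λ i → f (suc (m ↑ʳ i))) ≡⟨ cong (_+ ∑ (allFin n) (λ i → f (suc (m ↑ʳ i)))) (∑-allFin-suc m (λ i → f (i ↑ˡ n))) ⟨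
  ∑ (allFin (suc m)) (λ i → f (i ↑ˡ n)) + ∑ (allFin n) (λ i → f (suc m ↑ʳ i)) ∎
  where open ≡-Reasoning

-- The 3-graph with hyperedges {xᵢ , yⱼ , z_φ(j)}.
module Book (t : ℕ) (φ : Fin t → Fin t) where
  x y z : Fin t → Fin (t + (t + t))
  x i = i ↑ˡ (t + t)
  y j = t ↑ʳ (j ↑ˡ t)
  z j = t ↑ʳ (t ↑ʳ j)

  page : Fin t → Fin t → Subset (t + (t + t))
  page i j = ⁅ i ⁆ ++ᵛ (⁅ j ⁆ ++ᵛ ⁅ φ j ⁆)

  -- The first two blocks already determine `i` and `j`, so `φ` may be constant.
  page-injective : ∀ {i j i′ j′} → page i j ≡ page i′ j′ → i ≡ i′ × j ≡ j′
  page-injective {i} {j} {i′} {j′} e =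
    let eᵢ , e′ = ++-injective ⁅ i ⁆ ⁅ i′ ⁆ e
    in ⁅⁆-injective eᵢ , ⁅⁆-injective (proj₁ (++-injective ⁅ j ⁆ ⁅ j′ ⁆ e′))

  ∣page∣ : ∀ i j → ∣ page i j ∣ ≡ 3
  ∣page∣ i j = trans (∣p++q∣≡∣p∣+∣q∣ ⁅ i ⁆ (⁅ j ⁆ ++ᵛ ⁅ φ j ⁆))
    (cong₂ _+_ (Subset.∣⁅x⁆∣≡1 i) (trans (∣p++q∣≡∣p∣+∣q∣ ⁅ j ⁆ ⁅ φ j ⁆)
      (cong₂ _+_ (Subset.∣⁅x⁆∣≡1 j) (Subset.∣⁅x⁆∣≡1 (φ j)))))

  pages : List (Subset (t + (t + t)))
  pages = cartesianProductWith page (allFin t) (allFin t)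

  pages⁻ : ∀ {e} → e ∈ pages → ∃ λ i → ∃ λ j → e ≡ page i j
  pages⁻ e∈ = let i , j , _ , _ , eq = ∈-cartesianProductWith⁻ page (allFin t) (allFin t) e∈ in i , j , eq

  book : ThreeGraph (t + (t + t))
  book = record
    { edges = pages
    ; size3 = All.tabulate λ e∈ → let i , j , eq = pages⁻ e∈ in trans (cong ∣_∣ eq) (∣page∣ i j)
    ; distinct = cartesianProductWith⁺ page page-injective (allFin⁺ t) (allFin⁺ t) }

  data At (i j : Fin t) (v : Fin (t + (t + t))) : Set where
    atX : v ≡ x i → At i j v
    atY : v ≡ y j → At i j v
    atZ : v ≡ z (φ j) → At i j v

  page⁻ : ∀ {i j v} → v ∈ₛ page i j → At i j v
  page⁻ {i} {j} v∈ with ∈-++⁻ ⁅ i ⁆ (⁅ j ⁆ ++ᵛ ⁅ φ j ⁆) v∈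
  ... | inj₁ (i′ , refl , i′∈) = atX (cong x (Subset.x∈⁅y⁆⇒x≡y i i′∈))
  ... | inj₂ (_ , refl , v∈′) with ∈-++⁻ ⁅ j ⁆ ⁅ φ j ⁆ v∈′
  ...   | inj₁ (j′ , refl , j′∈) = atY (cong y (Subset.x∈⁅y⁆⇒x≡y j j′∈))
  ...   | inj₂ (k , refl , k∈)   = atZ (cong z (Subset.x∈⁅y⁆⇒x≡y (φ j) k∈))

  shadow-xy : ∀ i j → inShadow book (x i) (y j) ≡ true
  shadow-xy i j = ∧-true⁺ (does⁺ (x i Fin.<? y j) x<y) (does⁺ (inShadow? book (x i , y j)) xy∈)
    where
    x<y : x i Fin.< y j
    x<y = subst₂ _<_ (sym (Fin.toℕ-↑ˡ i (t + t))) (sym (Fin.toℕ-↑ʳ t (j ↑ˡ t)))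
      (<-≤-trans (Fin.toℕ<n i) (m≤m+n t _))
    xy∈ : InShadow book (x i) (y j)
    xy∈ = lose (∈-cartesianProductWith⁺ page (∈-allFin i) (∈-allFin j))
      ( ∈-++ˡ ⁅ i ⁆ (⁅ j ⁆ ++ᵛ ⁅ φ j ⁆) (Subset.x∈⁅x⁆ i)
      , ∈-++ʳ ⁅ i ⁆ (⁅ j ⁆ ++ᵛ ⁅ φ j ⁆) (∈-++ˡ ⁅ j ⁆ ⁅ φ j ⁆ (Subset.x∈⁅x⁆ j)) )

  shadow-large : t * t ≤ shadowSize book
  shadow-large = begin
    t * t                                                    ≡⟨ ∑-allFin-const t t ⟨
    ∑ (allFin t) (λ _ → t)                                   ≤⟨ ∑-mono (allFin t) row ⟩
    ∑ (allFin t) (λ i → # V (inShadow book (x i)))           ≤⟨ m≤m+n _ _ ⟩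
    ∑ (allFin t) (λ i → # V (inShadow book (x i))) + ∑ (allFin (t + t)) (λ i → # V (inShadow book (t ↑ʳ i)))
                                                             ≡⟨ ∑-allFin-+ t (t + t) (λ v → # V (inShadow book v)) ⟨
    ## (inShadow book)                                       ≡⟨ shadowSize≡## book ⟨
    shadowSize book                                          ∎
    where
    open ≤-Reasoning
    V = allFin (t + (t + t))
    row : ∀ i → t ≤ # V (inShadow book (x i))
    row i = begin
      t                                                      ≡⟨ trans (∑-allFin-const t 1) (*-identityʳ t) ⟨
      ∑ (allFin t) (λ _ → 1)                                 ≡⟨ ∑-cong (allFin t) (λ j → cong ⟦_⟧ (shadow-xy i j)) ⟨
      ∑ (allFin t) (λ j → r (y j))                           ≤⟨ m≤m+n _ _ ⟩
      ∑ (allFin t) (λ j → r (y j)) + ∑ (allFin t) (λ j → r (z j)) ≡⟨ ∑-allFin-+ t t (λ v → r (t ↑ʳ v)) ⟨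
      ∑ (allFin (t + t)) (λ v → r (t ↑ʳ v))                  ≤⟨ m≤n+m _ _ ⟩
      ∑ (allFin t) (λ v → r (x v)) + ∑ (allFin (t + t)) (λ v → r (t ↑ʳ v)) ≡⟨ ∑-allFin-+ t (t + t) r ⟨
      # V (inShadow book (x i))                              ∎
      where
      r : Fin (t + (t + t)) → ℕ
      r v = ⟦ inShadow book (x i) v ⟧

  isX : Fin (t + (t + t)) → Bool
  isX v = [ const true , const false ]′ (splitAt t v)

  isX-x : ∀ i → isX (x i) ≡ true
  isX-x i = cong [ const true , const false ]′ (Fin.splitAt-↑ˡ t i (t + t))

  isX-↑ʳ : ∀ j → isX (t ↑ʳ j) ≡ false
  isX-↑ʳ j = cong [ const true , const false ]′ (Fin.splitAt-↑ʳ t (t + t) j)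

  at-true : ∀ {i j v} → At i j v → isX v ≡ true → v ≡ x i
  at-true (atX e) _ = e
  at-true (atY e) c with () ← trans (sym c) (trans (cong isX e) (isX-↑ʳ _))
  at-true (atZ e) c with () ← trans (sym c) (trans (cong isX e) (isX-↑ʳ _))

  at-false : ∀ {i j v} → At i j v → isX v ≡ false → v ≡ y j ⊎ v ≡ z (φ j)
  at-false {i} (atX e) c with () ← trans (sym c) (trans (cong isX e) (isX-x i))
  at-false (atY e) _ = inj₁ e
  at-false (atZ e) _ = inj₂ e

  module _ {G : SimpleGraph m} (copy : BergeCopy G book) where
    open BergeCopy copy renaming (i to core; i-inj to core-inj)

    record On (u v : Fin m) (p : Adj G u v) : Set where
      field
        i j : Fin t
        f≡  : proj₁ (f u v p) ≡ page i j
        at-u : At i j (core u)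
        at-v : At i j (core v)

    on-page : ∀ u v (p : Adj G u v) → On u v p
    on-page u v p =
      let i , j , eq = pages⁻ (proj₂ (f u v p))
          u∈ , v∈ = contains u v p
      in record { i = i ; j = j ; f≡ = eq ; at-u = page⁻ (subst (core u ∈ₛ_) eq u∈) ; at-v = page⁻ (subst (core v ∈ₛ_) eq v∈) }

    core≢ : ∀ {u v} → Adj G u v → core u ≢ core v
    core≢ p e with refl ← core-inj e = irrefl G p

    colour : Fin m → Bool
    colour = isX ∘ core

    -- A page has a single x-vertex, so two distinct vertices of equal colour on it must be its
    -- y-vertex and its z-vertex.
    monochromatic : ∀ {u v} (p : Adj G u v) → colour u ≡ colour v → colour u ≡ false × ∃ λ j →
      (core u ≡ y j × core v ≡ z (φ j)) ⊎ (core u ≡ z (φ j) × core v ≡ y j)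
    monochromatic {u} {v} p c≡ with colour u in cu | on-page u v p
    ... | true  | o = ⊥-elim (core≢ p (trans (at-true (On.at-u o) cu) (sym (at-true (On.at-v o) (sym c≡)))))
    ... | false | o with at-false (On.at-u o) cu | at-false (On.at-v o) (sym c≡)
    ...   | inj₁ e | inj₁ e′ = ⊥-elim (core≢ p (trans e (sym e′)))
    ...   | inj₁ e | inj₂ e′ = refl , _ , inj₁ (e , e′)
    ...   | inj₂ e | inj₁ e′ = refl , _ , inj₂ (e , e′)
    ...   | inj₂ e | inj₂ e′ = ⊥-elim (core≢ p (trans e (sym e′)))

-- On 3t vertices the shadow has at least t² pairs, a proportion above 2/9, so `k = 10` already
-- contradicts the vanishing density. The conclusion is negative: no explicit copy is produced.
many-copies : ∀ {G : SimpleGraph m} → PiHat3Zero G → (φ : ∀ t → Fin (suc t) → Fin (suc t)) →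
              ¬ (∀ t → BergeFree G (Book.book (suc t) (φ t)))
many-copies π φ free with N , h ← π 10 (s≤s z≤n) = <⇒≱ (*-monoˡ-< (t * t) {9} {20} (s≤s (m≤m+n 9 10))) (begin
  20 * (t * t)                        ≡⟨ eq₁ (t * t) ⟩
  2 * (10 * (t * t))                  ≤⟨ *-monoʳ-≤ 2 (*-monoʳ-≤ 10 (Book.shadow-large t (φ N))) ⟩
  2 * (10 * shadowSize H)             ≤⟨ *-monoʳ-≤ 2 (h ν (≤-trans (n≤1+n N) (m≤m+n t _)) H (free N)) ⟩
  2 * (ν choose 2)                         ≤⟨ m≤m+n _ _ ⟩
  2 * (ν choose 2) + ν                     ≡⟨ 2*nC2+n≡n*n ν ⟩
  ν * ν                               ≡⟨ eq₂ t ⟩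
  9 * (t * t)                         ∎)
  where
  open ≤-Reasoning
  t = suc N
  ν = t + (t + t)
  H = Book.book t (φ N)
  eq₁ : ∀ s → 20 * s ≡ 2 * (10 * s)
  eq₁ = solve-∀
  eq₂ : ∀ t → (t + (t + t)) * (t + (t + t)) ≡ 9 * (t * t)
  eq₂ = solve-∀

-- A deletable vertex, from a constant `φ`

module _ {G : SimpleGraph (suc m)} {t : ℕ} where
  open Book (suc t) (λ _ → zero)

  module _ (copy : BergeCopy G book) where
    open BergeCopy copy renaming (i to core; i-inj to core-inj)

    proper : ∀ u w → core u ≢ z zero → core w ≢ z zero → Adj G u w → colour copy u ≢ colour copy w
    proper u w u≢z w≢z p c≡ with monochromatic copy p c≡
    ... | _ , _ , inj₁ (_ , e) = w≢z e
    ... | _ , _ , inj₂ (e , _) = u≢z e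

    bipartite-minus : ∃ λ v → BipartiteMinus G v
    bipartite-minus with Fin.any? (λ u → core u Fin.≟ z zero)
    ... | yes (v , e) = v , colour copy , λ u w u≢v w≢v →
            proper u w (λ e′ → u≢v (core-inj (trans e′ (sym e)))) (λ e′ → w≢v (core-inj (trans e′ (sym e))))
    -- If no vertex of `G` sits at `z zero`, the colouring is proper on all of `G`. Condition (1)
    -- still asks for a vertex to delete, which exists because `G` has `suc m` vertices.
    ... | no none = zero , colour copy , λ u w _ _ → proper u w (λ e → none (u , e)) (λ e → none (w , e))

-- Condition (2) with `B` taken to be all crossing edges and the part fixed as `false`. Unlike the
-- form with an arbitrary relation `B`, this can be decided.
MatchingColouring : SimpleGraph m → (Fin m → Bool) → Set
MatchingColouring G c =
  (∀ u v → Adj G u v → c u ≡ c v → c u ≡ false) ×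
  (∀ u v w → Adj G u v → c u ≡ c v → Adj G u w → c u ≡ c w → v ≡ w)

-- The matching and triangle-freeness, from `φ = id`

module _ {G : SimpleGraph m} {t : ℕ} (copy : BergeCopy G (Book.book (suc t) id)) where
  open Book (suc t) id
  open BergeCopy copy renaming (i to core; i-inj to core-inj)
  open SimpleGraph G using () renaming (sym to Adj-sym)

  private
    T = suc t

    -- Exchanges `y j` and `z j`. For `φ = id` the image of a monochromatic neighbour is the
    -- opposite of the vertex's own image, hence unique.
    opposite : Fin (T + (T + T)) → Fin (T + (T + T))
    opposite v = [ x , [ z , y ]′ ∘ splitAt T ]′ (splitAt T v)

    opposite-y : ∀ j → opposite (y j) ≡ z j
    opposite-y j = trans (cong [ x , [ z , y ]′ ∘ splitAt T ]′ (Fin.splitAt-↑ʳ T (T + T) (j ↑ˡ T)))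
      (cong [ z , y ]′ (Fin.splitAt-↑ˡ T j T))

    opposite-z : ∀ j → opposite (z j) ≡ y j
    opposite-z j = trans (cong [ x , [ z , y ]′ ∘ splitAt T ]′ (Fin.splitAt-↑ʳ T (T + T) (T ↑ʳ j)))
      (cong [ z , y ]′ (Fin.splitAt-↑ʳ T T j))

    index : Fin (T + (T + T)) → Fin T
    index v = [ id , [ id , id ]′ ∘ splitAt T ]′ (splitAt T v)

    index-x : ∀ i → index (x i) ≡ i
    index-x i = cong [ id , [ id , id ]′ ∘ splitAt T ]′ (Fin.splitAt-↑ˡ T i (T + T))

    index-yz : ∀ {v j} → v ≡ y j ⊎ v ≡ z j → index v ≡ j
    index-yz {j = j} (inj₁ refl) = trans (cong [ id , [ id , id ]′ ∘ splitAt T ]′ (Fin.splitAt-↑ʳ T (T + T) (j ↑ˡ T)))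
      (cong [ id , id ]′ (Fin.splitAt-↑ˡ T j T))
    index-yz {j = j} (inj₂ refl) = trans (cong [ id , [ id , id ]′ ∘ splitAt T ]′ (Fin.splitAt-↑ʳ T (T + T) (T ↑ʳ j)))
      (cong [ id , id ]′ (Fin.splitAt-↑ʳ T T j))

    c : Fin m → Bool
    c = colour copy

    mate-opposite : ∀ {u v} → Adj G u v → c u ≡ c v → core v ≡ opposite (core u)
    mate-opposite p c≡ with monochromatic copy p c≡
    ... | _ , _ , inj₁ (e , e′) = trans e′ (sym (trans (cong opposite e) (opposite-y _)))
    ... | _ , _ , inj₂ (e , e′) = trans e′ (sym (trans (cong opposite e) (opposite-z _)))

  matching-colouring : MatchingColouring G (colour copy)
  matching-colouring = (λ u v p c≡ → proj₁ (monochromatic copy p c≡)) ,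
    λ u v w p c≡ q c≡′ → core-inj (trans (mate-opposite p c≡) (sym (mate-opposite q c≡′)))

  private
    -- A triangle with one vertex among the xᵢ would use one hyperedge twice.
    no-apex : ∀ {u v w} → c u ≡ true → c v ≡ false → c w ≡ false → Adj G u v → Adj G v w → Adj G u w → ⊥
    no-apex {u} {v} {w} cu cv cw p q r = [ (λ (_ , e) → core≢ copy q (cong core e)) , (λ (e , _) → core≢ copy r (cong core e)) ]′
      (f-inj u v u w p r (trans (On.f≡ P) (trans (cong₂ page i≡ j≡) (sym (On.f≡ R)))))
      where
      P = on-page copy u v p
      Q = on-page copy v w q
      R = on-page copy u w r
      x-index : ∀ {i j} → At i j (core u) → index (core u) ≡ i
      x-index a = trans (cong index (at-true a cu)) (index-x _)
      i≡ : On.i P ≡ On.i R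
      i≡ = trans (sym (x-index (On.at-u P))) (x-index (On.at-u R))
      j≡ : On.j P ≡ On.j R
      j≡ = begin
        On.j P          ≡⟨ index-yz (at-false (On.at-v P) cv) ⟨
        index (core v)  ≡⟨ index-yz (at-false (On.at-u Q) cv) ⟩
        On.j Q          ≡⟨ index-yz (at-false (On.at-v Q) cw) ⟨
        index (core w)  ≡⟨ index-yz (at-false (On.at-v R) cw) ⟩
        On.j R          ∎
        where open ≡-Reasoning

    true-isolated : ∀ {u v} → Adj G u v → c u ≡ true → c v ≡ true → ⊥
    true-isolated p cu cv with () ← trans (sym cu) (proj₁ (monochromatic copy p (trans cu (sym cv))))

  -- Two vertices coloured `true` are never adjacent, exactly one is excluded by `no-apex`, and with
  -- none the edges at `u` contradict the matching.
  triangle-free : TriangleFree G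
  triangle-free u v w p q r with c u in cu | c v in cv | c w in cw
  ... | true  | true  | _     = true-isolated p cu cv
  ... | true  | false | true  = true-isolated r cu cw
  ... | false | true  | true  = true-isolated q cv cw
  ... | true  | false | false = no-apex cu cv cw p q r
  ... | false | true  | false = no-apex cv cu cw (Adj-sym p) r q
  ... | false | false | true  = no-apex cw cu cv (Adj-sym r) p (Adj-sym q)
  ... | false | false | false = core≢ copy q (cong core
          (proj₂ matching-colouring u v w p (trans cu (sym cv)) r (trans cu (sym cw))))

-- Removing the double negation

MatchingColouring-ext : ∀ (G : SimpleGraph m) {c d} → (∀ u → c u ≡ d u) → MatchingColouring G c → MatchingColouring G d
MatchingColouring-ext G h (inside , matching) =
  (λ u v p e → trans (sym (h u)) (inside u v p (back e))) ,
  λ u v w p e q e′ → matching u v w p (back e) q (back e′)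
  where
  back = λ {u} {v} e → trans (h u) (trans e (sym (h v)))

-- Colourings are represented by subsets, over which a finite search is available; a colouring
-- function agrees with its tabulation only pointwise, whence `MatchingColouring-ext`.
matchingColouring? : ∀ (G : SimpleGraph m) → Dec (∃ λ (p : Subset m) → MatchingColouring G (lookup p))
matchingColouring? G = Subset.anySubset? λ p →
  (Fin.all? λ u → Fin.all? λ v → Adj? G u v →-dec lookup p u Bool.≟ lookup p v →-dec lookup p u Bool.≟ false) ×-dec
  (Fin.all? λ u → Fin.all? λ v → Fin.all? λ w → Adj? G u v →-dec lookup p u Bool.≟ lookup p v →-dec
     Adj? G u w →-dec lookup p u Bool.≟ lookup p w →-dec v Fin.≟ w)

bipartiteMinus? : ∀ (G : SimpleGraph m) →
  Dec (∃ λ v → ∃ λ (p : Subset m) → ∀ u w → u ≢ v → w ≢ v → Adj G u w → lookup p u ≢ lookup p w)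
bipartiteMinus? G = Fin.any? λ v → Subset.anySubset? λ p → Fin.all? λ u → Fin.all? λ w →
  ¬? (u Fin.≟ v) →-dec ¬? (w Fin.≟ v) →-dec Adj? G u w →-dec ¬? (lookup p u Bool.≟ lookup p w)

matchingColouring⇒Condition2 : ∀ (G : SimpleGraph m) {c} → MatchingColouring G c → Condition2 G
matchingColouring⇒Condition2 G {c} (inside , matching) =
  c , (λ u v → Adj G u v × c u ≢ c v) , (λ _ _ → proj₁) , (λ _ _ (p , ne) → SimpleGraph.sym G p , ne ∘ sym) , (λ _ _ → proj₂) ,
  false ,
  (λ u v p ¬B → let e = mono p ¬B in inside u v p e , trans (sym e) (inside u v p e)) ,
  λ u v w p ¬B q ¬B′ → matching u v w p (mono p ¬B) q (mono q ¬B′)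
  where
  mono : ∀ {u v} → Adj G u v → ¬ (Adj G u v × c u ≢ c v) → c u ≡ c v
  mono {u} {v} p ¬B = decidable-stable (c u Bool.≟ c v) λ ne → ¬B (p , ne)

necessity : ∀ (G : SimpleGraph (suc m)) → PiHat3Zero G → Condition1 G × Condition2 G
necessity G π = (triangle , v , lookup p , p-proper) , matchingColouring⇒Condition2 G (proj₂ q)
  where
  triangle : TriangleFree G
  -- Triangle-freeness is itself a negation, so the doubly negated copy can be used directly.
  triangle a b c ab bc ac = many-copies π (λ _ → id) λ t copy → triangle-free copy a b c ab bc ac
  q = decidable-stable (matchingColouring? G) λ none → many-copies π (λ _ → id) λ t copy →
    let c = Book.colour (suc t) id copy
    in none (tabulateᵛ c , MatchingColouring-ext G {c} (λ u → sym (lookup∘tabulate c u)) (matching-colouring copy))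
  bip = decidable-stable (bipartiteMinus? G) λ none → many-copies π (λ _ _ → zero) λ t copy →
    let v , c , proper = bipartite-minus copy
    in none (v , tabulateᵛ c , λ u w u≢ w≢ p e → proper u w u≢ w≢ p
         (trans (sym (lookup∘tabulate c u)) (trans e (lookup∘tabulate c w))))
  v = proj₁ bip
  p = proj₁ (proj₂ bip)
  p-proper = proj₂ (proj₂ bip)

theorem3 : ∀ {m : ℕ} (G : SimpleGraph (suc m)) →
    (PiHat3Zero G → Condition1 G × Condition2 G) ×
    (Condition1 G × Condition2 G → PiHat3Zero G)
theorem3 G = necessity G , sufficiency G
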